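{- Let $\mathbb{K}$ be a field of characteristic zero and let $G$ be any graph (loopless, multiple edges allowed) on the vertex set $\{0,1,\dots,n\}$. Then the algebras $\mathcal{D}_G$ and $\mathcal{K}_G$ defined below are isomorphic as filtered algebras.
   Context: $\Phi_G$ is the commutative $\mathbb{K}$-algebra generated by variables $\phi_e$, one for each edge $e$ of $G$, with relations $\phi_e^2=0$. For a vertex $i$ and edge $e$: $c_{i,e}=1$ if $e$ joins $i$ to $j$ with $i<j$, $c_{i,e}=-1$ if $e$ joins $i$ to $j$ with $i>j$, and $c_{i,e}=0$ if $e$ is not incident to $i$. $X_i=\sum_e c_{i,e}\phi_e$ and $Y_i=\exp(X_i)=\prod_e(1+c_{i,e}\phi_e)$, $i=0,\dots,n$. $\mathcal{K}_G$ is the subalgebra of $\Phi_G$ generated by $1,Y_0,\dots,Y_n$, with the filtration whose $k$-th piece is the linear span of all products of at most $k$ of the elements $Y_0,\dots,Y_n$ (the empty product being $1$). For a set $I$ of vertices, $D_I$ is the number of edges with exactly one endpoint in $I$. $\mathcal{D}_G=\mathbb{K}[y_0,\dots,y_n]/\mathcal{I}_G$, where $\mathcal{I}_G$ is generated by $\left(\prod_{i\in I}y_i-1\right)^{D_I+1}$ for all nonempty $I\subseteq\{0,\dots,n\}$; its filtration has $k$-th piece the image of the polynomials of total degree at most $k$. An isomorphism of filtered algebras is an algebra isomorphism mapping the $k$-th filtration piece onto the $k$-th filtration piece for every $k$. -}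

module Defs where

open import Level using (_⊔_)
open import Algebra.Bundles using (CommutativeRing)
open import Data.Nat as ℕ using (ℕ; zero; suc)
open import Data.Fin as Fin using (Fin)
open import Data.Fin.Subset using (Subset; Nonempty)
open import Data.Vec as Vec using (Vec; []; _∷_)
open import Data.Bool using (Bool; true; false; if_then_else_; _∧_; not; _xor_)
open import Data.List as List using (List; []; _∷_; [_]; _++_)
open import Data.List.Relation.Unary.All using (All)
import Data.Nat.ListAction as ListAction
open import Data.Product using (Σ; ∃; _×_; _,_)
open import Relation.Nullary using (¬_; does)
open import Relation.Binary.PropositionalEquality using (_≢_)

-- Graphs: loopless multigraphs on vertex set {0,...,n} = Fin (suc n),
-- given by a finite family of edges e : Fin m, each joining src e and
-- tgt e (src e ≠ tgt e).  The orientation src/tgt is irrelevant below.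

record Graph (n : ℕ) : Set where
  field
    m        : ℕ
    src      : Fin m → Fin (suc n)
    tgt      : Fin m → Fin (suc n)
    loopless : ∀ e → src e ≢ tgt e
open Graph public

_∈ᵇ_ : ∀ {k} → Fin k → Subset k → Bool
i ∈ᵇ S = Vec.lookup S i

_⊆ᵇ_ : ∀ {k} → Subset k → Subset k → Bool
[] ⊆ᵇ [] = true
(a ∷ A) ⊆ᵇ (s ∷ S) = (not a Data.Bool.∨ s) ∧ (A ⊆ᵇ S)

_=ᵇ_ : ∀ {k} → Subset k → Subset k → Bool
[] =ᵇ [] = true
(a ∷ A) =ᵇ (s ∷ S) = does (a Data.Bool.≟ s) ∧ (A =ᵇ S)

_=ℕᵇ_ : ∀ {k} → Vec ℕ k → Vec ℕ k → Bool
[] =ℕᵇ [] = true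
(a ∷ A) =ℕᵇ (s ∷ S) = does (a ℕ.≟ s) ∧ (A =ℕᵇ S)

_∖ᵇ_ : ∀ {k} → Subset k → Subset k → Subset k
S ∖ᵇ A = Vec.zipWith (λ s a → s ∧ not a) S A

allSubsets : (k : ℕ) → List (Subset k)
allSubsets zero = [ [] ]
allSubsets (suc k) = List.map (false ∷_) (allSubsets k) ++ List.map (true ∷_) (allSubsets k)

D : ∀ {n} → Graph n → Subset (suc n) → ℕ
D G I = ListAction.sum (List.map (λ e → if (src G e ∈ᵇ I) xor (tgt G e ∈ᵇ I) then 1 else 0)
                           (List.allFin (m G)))

module _ {c ℓ} (K : CommutativeRing c ℓ) where
  open CommutativeRing K

  IsField : Set (c ⊔ ℓ)
  IsField = (¬ (1# ≈ 0#)) × (∀ x → ¬ (x ≈ 0#) → ∃ λ y → x * y ≈ 1#)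

  natK : ℕ → Carrier
  natK zero = 0#
  natK (suc k) = 1# + natK k

  CharZero : Set ℓ
  CharZero = ∀ k → ¬ (natK (suc k) ≈ 0#)

  sumK : List Carrier → Carrier
  sumK = List.foldr _+_ 0#

  -- Φ_G : elements are K-valued functions on subsets of edges
  -- (coefficients of the square-free monomials ∏_{e∈S} φ_e).

  module _ {n : ℕ} (G : Graph n) where

    Phi : Set c
    Phi = Subset (m G) → Carrier

    _≈Φ_ : Phi → Phi → Set ℓ
    f ≈Φ g = ∀ S → f S ≈ g S

    _+Φ_ : Phi → Phi → Phi
    (f +Φ g) S = f S + g S

    scaleΦ : Carrier → Phi → Phi
    scaleΦ a f S = a * f S

    -- product in Φ_G : (fg)(S) = Σ_{A ⊆ S} f(A) g(S ∖ A)   (φ_e² = 0)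
    _*Φ_ : Phi → Phi → Phi
    (f *Φ g) S = sumK (List.map (λ A → if A ⊆ᵇ S then f A * g (S ∖ᵇ A) else 0#)
                                (allSubsets (m G)))

    oneΦ : Phi
    oneΦ S = if S =ᵇ Vec.replicate (m G) false then 1# else 0#

    zeroΦ : Phi
    zeroΦ S = 0#

    φ : Fin (m G) → Phi
    φ e S = if S =ᵇ Data.Fin.Subset.⁅ e ⁆ then 1# else 0#

    coef : Fin (suc n) → Fin (m G) → Carrier
    coef i e =
      if does (i Fin.≟ src G e)
        then (if does (src G e Fin.<? tgt G e) then 1# else - 1#)
        else (if does (i Fin.≟ tgt G e)
                then (if does (tgt G e Fin.<? src G e) then 1# else - 1#)
                else 0#)

    Y : Fin (suc n) → Phi
    Y i = List.foldr (λ e acc → (oneΦ +Φ scaleΦ (coef i e) (φ e)) *Φ acc)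
                     oneΦ (List.allFin (m G))

    powΦ : Phi → ℕ → Phi
    powΦ f zero = oneΦ
    powΦ f (suc k) = f *Φ powΦ f k

    -- Polynomials in y_0,...,y_n over K, as formal sums of terms
    -- (coefficient , exponent vector).

    Mono : Set
    Mono = Vec ℕ (suc n)

    Poly : Set c
    Poly = List (Carrier × Mono)

    coeff : Poly → Mono → Carrier
    coeff p μ = sumK (List.map (λ { (a , ν) → if ν =ℕᵇ μ then a else 0# }) p)

    _≈P_ : Poly → Poly → Set ℓ
    p ≈P q = ∀ μ → coeff p μ ≈ coeff q μ

    constP : Carrier → Poly
    constP a = [ (a , Vec.replicate (suc n) 0) ]

    addP : Poly → Poly → Poly
    addP = _++_

    scaleP : Carrier → Poly → Poly
    scaleP a = List.map (λ { (b , ν) → (a * b , ν) })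

    negP : Poly → Poly
    negP = scaleP (- 1#)

    mulP : Poly → Poly → Poly
    mulP p q = List.concatMap (λ { (a , μ) →
                 List.map (λ { (b , ν) → (a * b , Vec.zipWith ℕ._+_ μ ν) }) q }) p

    powP : Poly → ℕ → Poly
    powP p zero = constP 1#
    powP p (suc k) = mulP p (powP p k)

    DegLe : ℕ → Poly → Set c
    DegLe k p = All (λ { (a , μ) → Vec.sum μ ℕ.≤ k }) p

    prodVars : Subset (suc n) → Poly
    prodVars I = [ (1# , Vec.map (λ b → if b then 1 else 0) I) ]

    gen : Subset (suc n) → Poly
    gen I = powP (addP (prodVars I) (negP (constP 1#))) (suc (D G I))

    InIdeal : Poly → Set (c ⊔ ℓ)
    InIdeal p = ∃ λ (L : List (Poly × Σ (Subset (suc n)) Nonempty)) →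
      p ≈P List.concatMap (λ { (h , (I , _)) → mulP h (gen I) }) L

    -- equality in 𝓓_G = K[y]/𝓘_G
    _~D_ : Poly → Poly → Set (c ⊔ ℓ)
    p ~D q = InIdeal (addP p (negP q))

    monoΦ : Mono → Phi
    monoΦ μ = List.foldr (λ i acc → powΦ (Y i) (Vec.lookup μ i) *Φ acc)
                         oneΦ (List.allFin (suc n))

    evalY : Poly → Phi
    evalY p = List.foldr (λ { (a , μ) acc → scaleΦ a (monoΦ μ) +Φ acc }) zeroΦ p

    -- membership in 𝓚_G (subalgebra generated by 1, Y_0, ..., Y_n)
    InK : Phi → Set (c ⊔ ℓ)
    InK x = ∃ λ p → evalY p ≈Φ x

    InKFilt : ℕ → Phi → Set (c ⊔ ℓ)
    InKFilt k x = ∃ λ p → DegLe k p × (evalY p ≈Φ x)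

    -- An isomorphism of filtered K-algebras 𝓓_G ≅ 𝓚_G, given by a map on
    -- representatives ψ : K[y_0..y_n] → Φ_G that is well defined on 𝓓_G,
    -- lands in 𝓚_G, is a unital K-algebra map, injective on 𝓓_G,
    -- surjective onto 𝓚_G, and maps the k-th filtration piece of 𝓓_G
    -- onto the k-th filtration piece of 𝓚_G.
    record FilteredIso : Set (c ⊔ ℓ) where
      field
        ψ          : Poly → Phi
        ψ-cong     : ∀ p q → p ~D q → ψ p ≈Φ ψ q
        ψ-into     : ∀ p → InK (ψ p)
        ψ-add      : ∀ p q → ψ (addP p q) ≈Φ (ψ p +Φ ψ q)
        ψ-scale    : ∀ a p → ψ (scaleP a p) ≈Φ scaleΦ a (ψ p)
        ψ-mul      : ∀ p q → ψ (mulP p q) ≈Φ (ψ p *Φ ψ q)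
        ψ-one      : ψ (constP 1#) ≈Φ oneΦ
        ψ-inj      : ∀ p q → ψ p ≈Φ ψ q → p ~D q
        ψ-surj     : ∀ x → InK x → ∃ λ p → ψ p ≈Φ x
        ψ-filt     : ∀ k p → DegLe k p → InKFilt k (ψ p)
        ψ-filt-onto : ∀ k x → InKFilt k x → ∃ λ p → DegLe k p × (ψ p ≈Φ x)

{-# OPTIONS --safe #-}
module Submission where

-- Since φ_e² = 0, adjoining the edge e = ij to a graph replaces Φ by its dual numbers, and for a
-- polynomial p one gets p(X) = p(X′) + φ_e · (∂_e p)(X′), where X′ belongs to the graph without e and
-- ∂_e = ∂/∂x_i − ∂/∂x_j.  This drives a deletion–contraction proof of the additive statement (Postnikov
-- and Shapiro) that the kernel of x_i ↦ X_i is generated by the powers (Σ_{i∈I} x_i)^(D_I + 1):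
-- if p(X) = 0, then ∂_e p lies in the ideal of the deletion G ∖ e; integrating by parts, it is ∂_e q for
-- some q in the ideal of G; and p − q, being killed by ∂_e, is a polynomial in x_i + x_j and the other
-- variables, hence comes from the contraction G / e.
--
-- The multiplicative statement follows from the additive one: in any algebra satisfying the relations of
-- 𝓓_G each y_i − 1 is nilpotent, so y_i = exp x_i for nilpotent x_i, and (Π_{i∈I} y_i − 1)^(D_I + 1) = 0
-- is equivalent to (Σ_{i∈I} x_i)^(D_I + 1) = 0, because (exp x − 1) / x is a unit.

-- Deletion and contraction do not carry over to the multiplicative side: there an edge acts by y_i
-- ∂/∂y_i - y_j ∂/∂y_j, for which y_i and y_j are eigenvectors, so this derivation is not locally
-- nilpotent. Local nilpotence, which holds for ∂_e because it sends variables to constants, is what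
-- makes integration by parts stop and what identifies the kernel of ∂_e. Hence the detour through
-- the additive statement and the exponential. Contraction can turn parallel edges into loops, so
-- the additive statement is proved for graphs with loops. Equality in K is not assumed decidable,
-- which rules out normal forms with nonzero coefficients. Polynomials are therefore terms modulo
-- the ring axioms where they are differentiated and substituted, and lists compared by their
-- coefficients where 𝓓_G is concerned; evaluation links the two.

open import Defs
open import Algebra.Bundles using (CommutativeRing; Monoid; RawRing)
open import Algebra.Core using (Op₁; Op₂)
import Algebra.Properties.AbelianGroup as AbelianGroupProperties
import Algebra.Properties.CommutativeMonoid.Sum as CommutativeMonoidSum
import Algebra.Properties.CommutativeSemiring.Exp as Exponentiation
import Algebra.Properties.Monoid.Sum as MonoidSum
import Algebra.Properties.Ring as RingIdentities
import Algebra.Properties.Semiring.Mult.TCOptimised as Mult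
import Algebra.Properties.Semiring.Sum as Summation
import Algebra.Solver.Ring as RingSolver
open import Algebra.Solver.Ring.AlmostCommutativeRing using (fromCommutativeRing; _-Raw-AlmostCommutative⟶_)
import Algebra.Solver.Ring.NaturalCoefficients.Default as NaturalSolver
open import Data.Bool using (Bool; true; false; if_then_else_; _∧_; _xor_; T)
import Data.Bool.Properties as Boolₚ
open import Data.Fin as Fin using (Fin; zero; suc)
import Data.Fin.Properties as Finₚ
open import Data.Fin.Subset using (Subset; Nonempty; ⁅_⁆)
open import Data.Fin.Subset.Properties using (nonempty?)
open import Data.List as List using (List; []; _∷_; _++_)
import Data.List.Properties as Listₚ
open import Data.Maybe using (Maybe; just; nothing)
open import Data.Nat as ℕ using (ℕ; zero; suc)
import Data.Nat.ListAction as ListAction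
import Data.Nat.Properties as ℕₚ
open import Data.Product using (Σ; ∃; _×_; _,_; proj₁; proj₂)
open import Data.Vec as Vec using (Vec; []; _∷_)
import Data.Vec.Properties as Vecₚ
open import Function using (_∘_; id)
open import Level using (_⊔_) renaming (suc to lsuc)
open import Relation.Binary using (IsEquivalence; Rel; Setoid; tri<; tri≈; tri>)
open import Relation.Binary.PropositionalEquality as ≡ using (_≡_; _≢_)
import Relation.Binary.Reasoning.Setoid as SetoidReasoning
open import Relation.Nullary using (Dec; does; yes; no; contradiction)
open import Relation.Nullary.Decidable using (dec-true; dec-false)

-- Solving ring identities with integer coefficients.

-- Integer coefficients are represented by differences of natural numbers.
module SolverInternals {a b} (R : CommutativeRing a b) where
  open CommutativeRing R hiding (zero)
  open Mult semiring using (×-homo-+; ×1-homo-*) renaming (_×_ to _×ᴿ_)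
  open AbelianGroupProperties +-abelianGroup using (ε⁻¹≈ε; ⁻¹-∙-comm; ⁻¹-involutive)
  open RingIdentities ring using (-‿distribˡ-*; -‿distribʳ-*)
  private
    module N = NaturalSolver commutativeSemiring

    -- The clause without subtraction, together with the optimised multiples, makes `(0 , 0)` and
    -- `(1 , 0)` evaluate to `0#` and `1#` definitionally, so goals solved with these constants
    -- carry no numerals.
    ⟦_⟧ℤ : ℕ × ℕ → Carrier
    ⟦ p , zero ⟧ℤ = p ×ᴿ 1#
    ⟦ p , suc q ⟧ℤ = p ×ᴿ 1# - suc q ×ᴿ 1#

    ⟦⟧-difference : ∀ p q → ⟦ p , q ⟧ℤ ≈ p ×ᴿ 1# - q ×ᴿ 1#
    ⟦⟧-difference p zero = sym (trans (+-congˡ ε⁻¹≈ε) (+-identityʳ _))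
    ⟦⟧-difference p (suc q) = refl

    normalise : ℕ → ℕ → ℕ × ℕ
    normalise (suc p) (suc q) = normalise p q
    normalise p q = p , q

    coefficients : RawRing _ _
    coefficients = record
      { Carrier = ℕ × ℕ ; _≈_ = _≡_
      ; _+_ = λ { (p , q) (p′ , q′) → normalise (p ℕ.+ p′) (q ℕ.+ q′) }
      ; _*_ = λ { (p , q) (p′ , q′) → normalise (p ℕ.* p′ ℕ.+ q ℕ.* q′) (p ℕ.* q′ ℕ.+ q ℕ.* p′) }
      ; -_ = λ { (p , q) → q , p } ; 0# = 0 , 0 ; 1# = 1 , 0 }

    open SetoidReasoning setoid

    shift-difference : ∀ x y z → x - y ≈ (x + z) + (- y - z)
    shift-difference x y z = begin
      x - y ≈⟨ +-identityʳ _ ⟨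
      (x - y) + 0# ≈⟨ +-congˡ (-‿inverseʳ z) ⟨
      (x - y) + (z - z) ≈⟨ N.solve 4 (λ x y z w → (x N.:+ y) N.:+ (z N.:+ w) N.:= (x N.:+ z) N.:+ (y N.:+ w)) refl x (- y) z (- z) ⟩
      (x + z) + (- y - z) ∎

    ⟦normalise⟧ : ∀ p q → ⟦ normalise p q ⟧ℤ ≈ p ×ᴿ 1# - q ×ᴿ 1#
    ⟦normalise⟧ (suc p) (suc q) = begin
      ⟦ normalise p q ⟧ℤ ≈⟨ ⟦normalise⟧ p q ⟩
      p ×ᴿ 1# - q ×ᴿ 1# ≈⟨ shift-difference _ _ 1# ⟩
      (p ×ᴿ 1# + 1#) + (- (q ×ᴿ 1#) - 1#) ≈⟨ +-cong (step p) (trans (⁻¹-∙-comm _ _) (-‿cong (step q))) ⟩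
      suc p ×ᴿ 1# - suc q ×ᴿ 1# ∎
      where
      step : ∀ p → p ×ᴿ 1# + 1# ≈ suc p ×ᴿ 1#
      step p = trans (+-comm _ _) (sym (×-homo-+ 1# 1 p))
    ⟦normalise⟧ zero q = ⟦⟧-difference zero q
    ⟦normalise⟧ (suc p) zero = ⟦⟧-difference (suc p) zero

    +-homo : ∀ x y → ⟦ RawRing._+_ coefficients x y ⟧ℤ ≈ ⟦ x ⟧ℤ + ⟦ y ⟧ℤ
    +-homo (p , q) (p′ , q′) = begin
      ⟦ normalise (p ℕ.+ p′) (q ℕ.+ q′) ⟧ℤ ≈⟨ ⟦normalise⟧ (p ℕ.+ p′) (q ℕ.+ q′) ⟩
      (p ℕ.+ p′) ×ᴿ 1# - (q ℕ.+ q′) ×ᴿ 1#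
        ≈⟨ +-cong (×-homo-+ 1# p p′) (-‿cong (×-homo-+ 1# q q′)) ⟩
      (p ×ᴿ 1# + p′ ×ᴿ 1#) - (q ×ᴿ 1# + q′ ×ᴿ 1#)
        ≈⟨ +-congˡ (⁻¹-∙-comm _ _) ⟨
      (p ×ᴿ 1# + p′ ×ᴿ 1#) + (- (q ×ᴿ 1#) + - (q′ ×ᴿ 1#))
        ≈⟨ N.solve 4 (λ x y z w → (x N.:+ y) N.:+ (z N.:+ w) N.:= (x N.:+ z) N.:+ (y N.:+ w)) refl _ _ _ _ ⟩
      (p ×ᴿ 1# - q ×ᴿ 1#) + (p′ ×ᴿ 1# - q′ ×ᴿ 1#)
        ≈⟨ +-cong (⟦⟧-difference p q) (⟦⟧-difference p′ q′) ⟨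
      ⟦ p , q ⟧ℤ + ⟦ p′ , q′ ⟧ℤ ∎

    difference-* : ∀ x y z w → (x * z + y * w) - (x * w + y * z) ≈ (x - y) * (z - w)
    difference-* x y z w = begin
      (x * z + y * w) - (x * w + y * z) ≈⟨ +-congˡ (⁻¹-∙-comm _ _) ⟨
      (x * z + y * w) + (- (x * w) + - (y * z))
        ≈⟨ +-cong (+-congˡ (trans (sym (⁻¹-involutive _))
             (trans (-‿cong (-‿distribˡ-* y w)) (-‿distribʳ-* (- y) w))))
             (+-cong (-‿distribʳ-* x w) (-‿distribˡ-* y z)) ⟩
      (x * z + - y * - w) + (x * - w + - y * z)
        ≈⟨ N.solve 4 (λ x y z w → ((x N.:* z N.:+ y N.:* w) N.:+ (x N.:* w N.:+ y N.:* z)) N.:= ((x N.:+ y) N.:* (z N.:+ w))) refl x (- y) z (- w) ⟩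
      (x - y) * (z - w) ∎

    *-homo : ∀ x y → ⟦ RawRing._*_ coefficients x y ⟧ℤ ≈ ⟦ x ⟧ℤ * ⟦ y ⟧ℤ
    *-homo (p , q) (p′ , q′) = begin
      ⟦ normalise (p ℕ.* p′ ℕ.+ q ℕ.* q′) (p ℕ.* q′ ℕ.+ q ℕ.* p′) ⟧ℤ
        ≈⟨ ⟦normalise⟧ (p ℕ.* p′ ℕ.+ q ℕ.* q′) (p ℕ.* q′ ℕ.+ q ℕ.* p′) ⟩
      (p ℕ.* p′ ℕ.+ q ℕ.* q′) ×ᴿ 1# - (p ℕ.* q′ ℕ.+ q ℕ.* p′) ×ᴿ 1#
        ≈⟨ +-cong (hom₂ p p′ q q′) (-‿cong (hom₂ p q′ q p′)) ⟩
      ((p ×ᴿ 1#) * (p′ ×ᴿ 1#) + (q ×ᴿ 1#) * (q′ ×ᴿ 1#)) - ((p ×ᴿ 1#) * (q′ ×ᴿ 1#) + (q ×ᴿ 1#) * (p′ ×ᴿ 1#))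
        ≈⟨ difference-* (p ×ᴿ 1#) (q ×ᴿ 1#) (p′ ×ᴿ 1#) (q′ ×ᴿ 1#) ⟩
      (p ×ᴿ 1# - q ×ᴿ 1#) * (p′ ×ᴿ 1# - q′ ×ᴿ 1#)
        ≈⟨ *-cong (⟦⟧-difference p q) (⟦⟧-difference p′ q′) ⟨
      ⟦ p , q ⟧ℤ * ⟦ p′ , q′ ⟧ℤ ∎
      where
      hom₂ : ∀ p p′ q q′ → (p ℕ.* p′ ℕ.+ q ℕ.* q′) ×ᴿ 1# ≈ (p ×ᴿ 1#) * (p′ ×ᴿ 1#) + (q ×ᴿ 1#) * (q′ ×ᴿ 1#)
      hom₂ p p′ q q′ = trans (×-homo-+ 1# (p ℕ.* p′) (q ℕ.* q′)) (+-cong (×1-homo-* p p′) (×1-homo-* q q′))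

    neg-homo : ∀ x → ⟦ RawRing.-_ coefficients x ⟧ℤ ≈ - ⟦ x ⟧ℤ
    neg-homo (p , q) = begin
      ⟦ q , p ⟧ℤ ≈⟨ ⟦⟧-difference q p ⟩
      q ×ᴿ 1# - p ×ᴿ 1# ≈⟨ +-congʳ (⁻¹-involutive _) ⟨
      - - (q ×ᴿ 1#) - p ×ᴿ 1# ≈⟨ +-comm _ _ ⟩
      - (p ×ᴿ 1#) - - (q ×ᴿ 1#) ≈⟨ ⁻¹-∙-comm _ _ ⟩
      - (p ×ᴿ 1# - q ×ᴿ 1#) ≈⟨ -‿cong (⟦⟧-difference p q) ⟨
      - ⟦ p , q ⟧ℤ ∎

    morphism : coefficients -Raw-AlmostCommutative⟶ fromCommutativeRing R
    morphism = record
      { ⟦_⟧ = ⟦_⟧ℤ ; +-homo = +-homo ; *-homo = *-homo ; -‿homo = neg-homo ; 0-homo = refl ; 1-homo = refl }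

    weak-decision : ∀ x y → Maybe (⟦ x ⟧ℤ ≈ ⟦ y ⟧ℤ)
    weak-decision (p , q) (p′ , q′) with p ℕ.+ q′ ℕ.≟ p′ ℕ.+ q
    ... | no _ = nothing
    ... | yes e = just (begin
      ⟦ p , q ⟧ℤ ≈⟨ ⟦⟧-difference p q ⟩
      P - Q ≈⟨ shift-difference P Q Q′ ⟩
      (P + Q′) + (- Q - Q′) ≈⟨ +-cong sums (+-comm _ _) ⟩
      (P′ + Q) + (- Q′ - Q) ≈⟨ shift-difference P′ Q′ Q ⟨
      P′ - Q′ ≈⟨ ⟦⟧-difference p′ q′ ⟨
      ⟦ p′ , q′ ⟧ℤ ∎)
      where
      P = p ×ᴿ 1#
      Q = q ×ᴿ 1#
      P′ = p′ ×ᴿ 1#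
      Q′ = q′ ×ᴿ 1#
      sums : P + Q′ ≈ P′ + Q
      sums = trans (sym (×-homo-+ 1# p q′)) (trans (reflexive (≡.cong (_×ᴿ 1#) e)) (×-homo-+ 1# p′ q))

  module I = RingSolver coefficients (fromCommutativeRing R) morphism weak-decision

  negate : ∀ {n} → I.Polynomial n → I.Polynomial n
  negate p = I.:- p

  equation : ∀ {n} → I.Polynomial n → I.Polynomial n → I.Polynomial n × I.Polynomial n
  equation p q = p , q

  constant-0 constant-1 : ∀ {n} → I.Polynomial n
  constant-0 = I.con (0 , 0)
  constant-1 = I.con (1 , 0)

module IntegerSolver {a b} (R : CommutativeRing a b) where
  private
    P : ℕ → Set
    P = SolverInternals.I.Polynomial R

  infix  9 :-_
  infixl 8 _:*_
  infixl 7 _:+_ _:-_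
  infix 4 _:=_

  _:+_ _:*_ _:-_ : ∀ {n} → P n → P n → P n
  _:+_ = SolverInternals.I._:+_ R
  _:*_ = SolverInternals.I._:*_ R
  _:-_ = SolverInternals.I._:-_ R

  :-_ : ∀ {n} → P n → P n
  :-_ = SolverInternals.negate R

  _:=_ : ∀ {n} → P n → P n → P n × P n
  _:=_ = SolverInternals.equation R

  :0 :1 : ∀ {n} → P n
  :0 = SolverInternals.constant-0 R
  :1 = SolverInternals.constant-1 R

  solve = SolverInternals.I.solve R

-- Commutative rings: powers, nilpotent elements, finite sums and products.

module _ {a b} (M : Monoid a b) where
  open Monoid M
  open MonoidSum M

  fold-single : ∀ {n} (f : Fin n → Carrier) i → sum (λ l → if does (l Fin.≟ i) then f l else ε) ≈ f i
  fold-single {suc n} f zero = trans (∙-congˡ (sum-replicate-zero n)) (identityʳ _)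
  fold-single {suc n} f (suc i) = trans (identityˡ _) (fold-single (λ l → f (suc l)) i)

module RingProperties {a b} (R : CommutativeRing a b) where
  open CommutativeRing R hiding (zero)
  open IntegerSolver R
  open Exponentiation commutativeSemiring public
  open Summation semiring public
  open CommutativeMonoidSum *-commutativeMonoid public using ()
    renaming (sum to product; sum-cong-≋ to product-cong; ∑-distrib-+ to ∏-distrib-*; sum-replicate-zero to product-replicate-one)
  open SetoidReasoning setoid

  ^-annihilates-+ : ∀ x j k → x ^ k ≈ 0# → x ^ (j ℕ.+ k) ≈ 0#
  ^-annihilates-+ x j k x^k≈0 = trans (^-homo-* x j k) (trans (*-congˡ x^k≈0) (zeroʳ _))

  ^-zero-multiple : ∀ {x y} k → x ^ k ≈ 0# → (x * y) ^ k ≈ 0#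
  ^-zero-multiple {x} {y} k x^k≈0 = trans (^-distrib-* x y k) (trans (*-congʳ x^k≈0) (zeroˡ _))

  -- The factors `x + y` are expanded one at a time instead of by the binomial theorem. The weight
  -- `w` collects the choices made so far: choosing `x` lowers `j`, choosing `y` lowers `k`, and the
  -- product is already zero when either is used up.
  ^-zero-+ : ∀ {x y} j k → x ^ j ≈ 0# → y ^ k ≈ 0# → (x + y) ^ (j ℕ.+ k) ≈ 0#
  ^-zero-+ {x} {y} j k x^j≈0 y^k≈0 = trans (sym (*-identityˡ _))
    (weighted j k 1# (trans (*-identityˡ _) x^j≈0) (trans (*-identityˡ _) y^k≈0))
    where
    absorb : ∀ {w} u v → w * v ≈ 0# → (w * u) * v ≈ 0#
    absorb {w} u v wv≈0 = trans (solve 3 (λ w u v → (w :* u) :* v := u :* (w :* v)) refl w u v)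
      (trans (*-congˡ wv≈0) (zeroʳ u))
    weighted : ∀ j k w → w * x ^ j ≈ 0# → w * y ^ k ≈ 0# → w * (x + y) ^ (j ℕ.+ k) ≈ 0#
    weighted zero k w w≈0 _ = trans (*-congʳ (trans (sym (*-identityʳ w)) w≈0)) (zeroˡ _)
    weighted (suc j) zero w _ w≈0 = trans (*-congʳ (trans (sym (*-identityʳ w)) w≈0)) (zeroˡ _)
    weighted (suc j) (suc k) w p q = begin
      w * ((x + y) * (x + y) ^ (j ℕ.+ suc k))
        ≈⟨ solve 4 (λ w x y z → w :* ((x :+ y) :* z) := (w :* x) :* z :+ (w :* y) :* z) refl w x y _ ⟩
      (w * x) * (x + y) ^ (j ℕ.+ suc k) + (w * y) * (x + y) ^ (j ℕ.+ suc k)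
        ≈⟨ +-cong (weighted j (suc k) (w * x) (trans (*-assoc _ _ _) p) (absorb x _ q))
             (trans (*-congˡ (^-congʳ (x + y) (ℕₚ.+-suc j k)))
               (weighted (suc j) k (w * y) (absorb y _ p) (trans (*-assoc _ _ _) q))) ⟩
      0# + 0# ≈⟨ +-identityʳ 0# ⟩
      0# ∎

  fixed-by-nilpotent : ∀ {x n} k → n ^ k ≈ 0# → x ≈ n * x → x ≈ 0#
  fixed-by-nilpotent {x} {n} k n^k≈0 x≈nx = trans (iterate k) (trans (*-congʳ n^k≈0) (zeroˡ x))
    where
    iterate : ∀ k → x ≈ n ^ k * x
    iterate zero = sym (*-identityˡ x)
    iterate (suc k) = trans x≈nx (trans (*-congˡ (iterate k)) (sym (*-assoc n (n ^ k) x)))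

  -- The factor `1# + x * z` is a unit because `x` is nilpotent, but its inverse is not written
  -- down: from w (1 + xz) = 0 follows w = -xz w, and an element fixed by a nilpotent factor is
  -- zero. One factor is stripped at a time.
  cancel-unipotent : ∀ {x z k} → x ^ k ≈ 0# → ∀ d → (x * (1# + x * z)) ^ d ≈ 0# → x ^ d ≈ 0#
  cancel-unipotent {x} {z} {k} x^k≈0 d q = strip d (x ^ d) (trans (sym (^-distrib-* x _ d)) q)
    where
    strip : ∀ d w → w * (1# + x * z) ^ d ≈ 0# → w ≈ 0#
    strip zero w p = trans (sym (*-identityʳ w)) p
    strip (suc d) w p = fixed-by-nilpotent k (^-zero-multiple {x} { - z} k x^k≈0) (begin
      w ≈⟨ solve 3 (λ w x z → w := w :* (:1 :+ x :* z) :+ (x :* :- z) :* w) refl w x z ⟩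
      w * (1# + x * z) + (x * - z) * w
        ≈⟨ +-congʳ (strip d _ (trans (*-assoc _ _ _) p)) ⟩
      0# + (x * - z) * w ≈⟨ +-identityˡ _ ⟩
      (x * - z) * w ∎)

  sum-single : ∀ {n} (f : Fin n → Carrier) i → sum (λ l → if does (l Fin.≟ i) then f l else 0#) ≈ f i
  sum-single = fold-single +-monoid

  product-single : ∀ {n} (f : Fin n → Carrier) i → product (λ l → if does (l Fin.≟ i) then f l else 1#) ≈ f i
  product-single = fold-single *-monoid

  x-y≈0⇒x≈y : ∀ {x y} → x - y ≈ 0# → x ≈ y
  x-y≈0⇒x≈y {x} {y} p = begin
    x ≈⟨ solve 2 (λ x y → x := (x :- y) :+ y) refl x y ⟩
    (x - y) + y ≈⟨ +-congʳ p ⟩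
    0# + y ≈⟨ +-identityˡ y ⟩
    y ∎

  x≈y⇒x-y≈0 : ∀ {x y} → x ≈ y → x - y ≈ 0#
  x≈y⇒x-y≈0 {x} {y} p = trans (+-congʳ p) (-‿inverseʳ y)

module _ {a b} {A : Set a} (_≈_ : Rel A b) (_+_ _*_ : Op₂ A) (-_ : Op₁ A) (0# 1# : A) where
  open import Algebra.Definitions _≈_

  makeCommutativeRing : IsEquivalence _≈_ →
    Congruent₂ _+_ → Associative _+_ → Commutative _+_ → LeftIdentity 0# _+_ →
    Congruent₁ -_ → LeftInverse 0# -_ _+_ →
    Congruent₂ _*_ → Associative _*_ → Commutative _*_ → LeftIdentity 1# _*_ →
    _*_ DistributesOverˡ _+_ → CommutativeRing a b
  makeCommutativeRing eq +-cong +-assoc +-comm +-idˡ -cong -invˡ *-cong *-assoc *-comm *-idˡ distribˡ = record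
    { Carrier = A ; _≈_ = _≈_ ; _+_ = _+_ ; _*_ = _*_ ; -_ = -_ ; 0# = 0# ; 1# = 1#
    ; isCommutativeRing = record
      { *-comm = *-comm
      ; isRing = record
        { +-isAbelianGroup = record
          { comm = +-comm
          ; isGroup = record
            { inverse = comm∧invˡ⇒inv +-comm -invˡ
            ; ⁻¹-cong = -cong
            ; isMonoid = record
              { identity = comm∧idˡ⇒id +-comm +-idˡ
              ; isSemigroup = record
                { assoc = +-assoc
                ; isMagma = record { isEquivalence = eq ; ∙-cong = +-cong } } } } }
        ; *-cong = *-cong
        ; *-assoc = *-assoc
        ; *-identity = comm∧idˡ⇒id *-comm *-idˡ
        ; distrib = comm∧distrˡ⇒distr +-cong *-comm distribˡ } } }
    where
    setoid : Setoid a b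
    setoid = record { isEquivalence = eq }
    open import Algebra.Consequences.Setoid setoid using (comm∧idˡ⇒id; comm∧distrˡ⇒distr; comm∧invˡ⇒inv)

-- Commutative algebras over K, truncated power series.

record KAlgebra {c ℓ} (K : CommutativeRing c ℓ) a b : Set (c ⊔ ℓ ⊔ lsuc (a ⊔ b)) where
  private module K = CommutativeRing K
  field
    commutativeRing : CommutativeRing a b
  open CommutativeRing commutativeRing hiding (zero) public
  field
    ι      : K.Carrier → Carrier
    ι-cong : ∀ {x y} → x K.≈ y → ι x ≈ ι y
    ι-+    : ∀ x y → ι (x K.+ y) ≈ ι x + ι y
    ι-*    : ∀ x y → ι (x K.* y) ≈ ι x * ι y
    ι-1    : ι K.1# ≈ 1#
  open IntegerSolver commutativeRing public
  open RingProperties commutativeRing public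
  module ≈-Reasoning = SetoidReasoning setoid

  ι-0 : ι K.0# ≈ 0#
  ι-0 = begin
    ι K.0#                       ≈⟨ solve 1 (λ x → x := (x :+ x) :- x) refl _ ⟩
    (ι K.0# + ι K.0#) - ι K.0#   ≈⟨ +-congʳ (trans (sym (ι-+ _ _)) (ι-cong (K.+-identityˡ K.0#))) ⟩
    ι K.0# - ι K.0#              ≈⟨ -‿inverseʳ _ ⟩
    0#                           ∎
    where
    open ≈-Reasoning

  ι-neg : ∀ x → ι (K.- x) ≈ - ι x
  ι-neg x = begin
    ι (K.- x)                    ≈⟨ solve 2 (λ x y → y := (x :+ y) :- x) refl (ι x) _ ⟩
    (ι x + ι (K.- x)) - ι x      ≈⟨ +-congʳ (trans (sym (ι-+ _ _)) (trans (ι-cong (K.-‿inverseʳ x)) ι-0)) ⟩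
    0# - ι x                     ≈⟨ +-identityˡ _ ⟩
    - ι x                        ∎
    where
    open ≈-Reasoning

  partialSum : ℕ → (ℕ → Carrier) → Carrier
  partialSum zero f = 0#
  partialSum (suc t) f = f 0 + partialSum t (f ∘ suc)

  partialSum-cong : ∀ t {f g} → (∀ k → f k ≈ g k) → partialSum t f ≈ partialSum t g
  partialSum-cong zero e = refl
  partialSum-cong (suc t) e = +-cong (e 0) (partialSum-cong t (e ∘ suc))

  partialSum-+ : ∀ t f g → partialSum t (λ k → f k + g k) ≈ partialSum t f + partialSum t g
  partialSum-+ zero f g = sym (+-identityˡ 0#)
  partialSum-+ (suc t) f g = trans (+-congˡ (partialSum-+ t (f ∘ suc) (g ∘ suc)))
    (solve 4 (λ p q r s → (p :+ q) :+ (r :+ s) := (p :+ r) :+ (q :+ s)) refl _ _ _ _)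

  partialSum-* : ∀ t x f → partialSum t (λ k → x * f k) ≈ x * partialSum t f
  partialSum-* zero x f = sym (zeroʳ x)
  partialSum-* (suc t) x f = trans (+-congˡ (partialSum-* t x (f ∘ suc))) (sym (distribˡ x _ _))

  partialSum-zero : ∀ t {f} → (∀ k → f k ≈ 0#) → partialSum t f ≈ 0#
  partialSum-zero zero e = refl
  partialSum-zero (suc t) e = trans (+-cong (e 0) (partialSum-zero t (e ∘ suc))) (+-identityˡ 0#)

  partialSum-stable : ∀ p t {f} → (∀ k → f (p ℕ.+ k) ≈ 0#) → partialSum (p ℕ.+ t) f ≈ partialSum p f
  partialSum-stable zero t e = partialSum-zero t e
  partialSum-stable (suc p) t e = +-congˡ (partialSum-stable p t e)

  convolution : (ℕ → Carrier) → (ℕ → Carrier) → ℕ → Carrier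
  convolution f g zero = f 0 * g 0
  convolution f g (suc n) = f 0 * g (suc n) + convolution (f ∘ suc) g n

  convolution-cong : ∀ n {f f′ g g′} → (∀ k → f k ≈ f′ k) → (∀ k → g k ≈ g′ k) →
    convolution f g n ≈ convolution f′ g′ n
  convolution-cong zero e e′ = *-cong (e 0) (e′ 0)
  convolution-cong (suc n) e e′ = +-cong (*-cong (e 0) (e′ (suc n))) (convolution-cong n (e ∘ suc) e′)

  convolution-+ˡ : ∀ n f f′ g → convolution (λ k → f k + f′ k) g n ≈ convolution f g n + convolution f′ g n
  convolution-+ˡ zero f f′ g = distribʳ (g 0) _ _
  convolution-+ˡ (suc n) f f′ g = trans (+-congˡ (convolution-+ˡ n (f ∘ suc) (f′ ∘ suc) g))
    (solve 5 (λ p q r s t → (p :+ q) :* r :+ (s :+ t) := (p :* r :+ s) :+ (q :* r :+ t)) refl _ _ _ _ _)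

  convolution-*ˡ : ∀ n x f g → convolution (λ k → x * f k) g n ≈ x * convolution f g n
  convolution-*ˡ zero x f g = *-assoc _ _ _
  convolution-*ˡ (suc n) x f g = trans (+-congˡ (convolution-*ˡ n x (f ∘ suc) g))
    (solve 4 (λ x p q r → (x :* p) :* q :+ x :* r := x :* (p :* q :+ r)) refl _ _ _ _)

  convolution-*ʳ : ∀ n x f g → convolution f (λ k → x * g k) n ≈ x * convolution f g n
  convolution-*ʳ zero x f g = solve 3 (λ x p q → p :* (x :* q) := x :* (p :* q)) refl _ _ _
  convolution-*ʳ (suc n) x f g = trans (+-congˡ (convolution-*ʳ n x (f ∘ suc) g))
    (solve 4 (λ x p q r → p :* (x :* q) :+ x :* r := x :* (p :* q :+ r)) refl _ _ _ _)

  convolution-zeroˡ : ∀ n {f} g → (∀ k → f k ≈ 0#) → convolution f g n ≈ 0#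
  convolution-zeroˡ zero g e = trans (*-congʳ (e 0)) (zeroˡ _)
  convolution-zeroˡ (suc n) g e = trans (+-cong (trans (*-congʳ (e 0)) (zeroˡ _)) (convolution-zeroˡ n g (e ∘ suc)))
    (+-identityˡ 0#)

  -- Truncating the product series at `p + q` loses nothing: a product f a * g b survives only for a
  -- < p and b < q, and then a + b < p + q.
  partialSum-convolution : ∀ p q f g → (∀ k → f (p ℕ.+ k) ≈ 0#) → (∀ k → g (q ℕ.+ k) ≈ 0#) →
    partialSum (p ℕ.+ q) (convolution f g) ≈ partialSum (p ℕ.+ q) f * partialSum q g
  partialSum-convolution zero q f g f≈0 g≈0 = begin
    partialSum q (convolution f g)     ≈⟨ partialSum-zero q (λ n → convolution-zeroˡ n g f≈0) ⟩
    0#                                 ≈⟨ zeroˡ _ ⟨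
    0# * partialSum q g                ≈⟨ *-congʳ (partialSum-zero q f≈0) ⟨
    partialSum q f * partialSum q g    ∎
    where
    open ≈-Reasoning
  partialSum-convolution (suc p) q f g f≈0 g≈0 = begin
    f 0 * g 0 + partialSum (p ℕ.+ q) (λ n → f 0 * g (suc n) + convolution (f ∘ suc) g n)
      ≈⟨ +-congˡ (trans (partialSum-+ (p ℕ.+ q) _ _)
           (+-cong (partialSum-* (p ℕ.+ q) (f 0) (g ∘ suc)) (partialSum-convolution p q (f ∘ suc) g f≈0 g≈0))) ⟩
    f 0 * g 0 + (f 0 * partialSum (p ℕ.+ q) (g ∘ suc) + F * partialSum q g)
      ≈⟨ solve 4 (λ x y z w → x :* y :+ (x :* z :+ w) := x :* (y :+ z) :+ w) refl _ _ _ _ ⟩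
    f 0 * partialSum (suc p ℕ.+ q) g + F * partialSum q g
      ≈⟨ +-congʳ (*-congˡ (trans (reflexive (≡.cong (λ t → partialSum t g) (ℕₚ.+-comm (suc p) q)))
           (partialSum-stable q (suc p) g≈0))) ⟩
    f 0 * partialSum q g + F * partialSum q g ≈⟨ distribʳ _ _ _ ⟨
    (f 0 + F) * partialSum q g ∎
    where
    open ≈-Reasoning
    F = partialSum (p ℕ.+ q) (f ∘ suc)

-- Exponentials and logarithms of nilpotent and unipotent elements.

module Exponential {c ℓ} (K : CommutativeRing c ℓ) (inv : ℕ → CommutativeRing.Carrier K)
  (inv-correct : ∀ k → CommutativeRing._≈_ K (CommutativeRing._*_ K (natK K (suc k)) (inv k)) (CommutativeRing.1# K))
  {a b} (A : KAlgebra K a b) where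
  private module K = CommutativeRing K
  open KAlgebra A
  open ≈-Reasoning

  ιnat : ℕ → Carrier
  ιnat k = ι (natK K k)

  ιinv : ℕ → Carrier
  ιinv k = ι (inv k)

  ιnat*ιinv : ∀ k → ιnat (suc k) * ιinv k ≈ 1#
  ιnat*ιinv k = trans (sym (ι-* _ _)) (trans (ι-cong (inv-correct k)) ι-1)

  ιnat-suc : ∀ k → ιnat (suc k) ≈ 1# + ιnat k
  ιnat-suc k = trans (ι-+ _ _) (+-congʳ ι-1)

  ιnat-1 : ιnat 1 ≈ 1#
  ιnat-1 = trans (ιnat-suc 0) (trans (+-congˡ ι-0) (+-identityʳ 1#))

  ιinv-0 : ιinv 0 ≈ 1#
  ιinv-0 = trans (sym (*-identityˡ _)) (trans (*-congʳ (sym ιnat-1)) (ιnat*ιinv 0))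

  ιnat-cancel : ∀ k {x} → ιnat (suc k) * x ≈ 0# → x ≈ 0#
  ιnat-cancel k {x} e = begin
    x                              ≈⟨ *-identityˡ x ⟨
    1# * x                         ≈⟨ *-congʳ (ιnat*ιinv k) ⟨
    (ιnat (suc k) * ιinv k) * x    ≈⟨ solve 3 (λ m n x → (m :* n) :* x := n :* (m :* x)) refl _ _ _ ⟩
    ιinv k * (ιnat (suc k) * x)    ≈⟨ *-congˡ e ⟩
    ιinv k * 0#                    ≈⟨ zeroʳ _ ⟩
    0#                             ∎

  -- The divided power x^k / k!, since `inv k` inverts k + 1.
  γ : Carrier → ℕ → Carrier
  γ x zero = 1#
  γ x (suc k) = x * (ιinv k * γ x k)

  γ-cong : ∀ {x y} k → x ≈ y → γ x k ≈ γ y k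
  γ-cong zero e = refl
  γ-cong (suc k) e = *-cong e (*-congˡ (γ-cong k e))

  γ-multiple : ∀ x k → ∃ λ q → γ x k ≈ x ^ k * q
  γ-multiple x zero = 1# , sym (*-identityˡ 1#)
  γ-multiple x (suc k) with γ-multiple x k
  ... | q , e = ιinv k * q , trans (*-congˡ (*-congˡ e))
    (solve 4 (λ x i y q → x :* (i :* (y :* q)) := (x :* y) :* (i :* q)) refl _ _ _ _)

  γ-vanishes : ∀ {x} p → x ^ p ≈ 0# → ∀ k → γ x (p ℕ.+ k) ≈ 0#
  γ-vanishes {x} p x^p≈0 k with γ-multiple x (p ℕ.+ k)
  ... | q , e = trans e (trans (*-congʳ (trans (^-congʳ x (ℕₚ.+-comm p k)) (^-annihilates-+ x k p x^p≈0))) (zeroˡ q))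

  -- Coefficients of the formal derivative, where `f` lists those of a power series; `convolution`
  -- multiplies such series.
  derivative : (ℕ → Carrier) → ℕ → Carrier
  derivative f n = ιnat (suc n) * f (suc n)

  derivative-γ : ∀ x n → derivative (γ x) n ≈ x * γ x n
  derivative-γ x n = begin
    ιnat (suc n) * (x * (ιinv n * γ x n))   ≈⟨ solve 4 (λ m x i y → m :* (x :* (i :* y)) := (m :* i) :* (x :* y)) refl _ _ _ _ ⟩
    (ιnat (suc n) * ιinv n) * (x * γ x n)   ≈⟨ *-congʳ (ιnat*ιinv n) ⟩
    1# * (x * γ x n)                        ≈⟨ *-identityˡ _ ⟩
    x * γ x n                               ∎

  derivative-convolution : ∀ n f g →
    derivative (convolution f g) n ≈ convolution (derivative f) g n + convolution f (derivative g) n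
  derivative-convolution zero f g =
    solve 5 (λ m x y z w → m :* (x :* w :+ y :* z) := (m :* y) :* z :+ x :* (m :* w)) refl (ιnat 1) (f 0) (f 1) (g 0) (g 1)
  derivative-convolution (suc n) f g = begin
    ιnat (2 ℕ.+ n) * (f 0 * g (2 ℕ.+ n) + (f 1 * g (suc n) + C))
      ≈⟨ solve 4 (λ m x y z → m :* (x :* y :+ z) := x :* (m :* y) :+ m :* z) refl _ _ _ _ ⟩
    f 0 * dg (suc n) + ιnat (2 ℕ.+ n) * (f 1 * g (suc n) + C)
      ≈⟨ +-congˡ (*-congʳ (ιnat-suc (suc n))) ⟩
    f 0 * dg (suc n) + (1# + ιnat (suc n)) * (f 1 * g (suc n) + C)
      ≈⟨ +-congˡ (solve 2 (λ m z → (:1 :+ m) :* z := z :+ m :* z) refl _ _) ⟩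
    f 0 * dg (suc n) + ((f 1 * g (suc n) + C) + ιnat (suc n) * (f 1 * g (suc n) + C))
      ≈⟨ +-congˡ (+-cong (+-congʳ (*-congʳ (trans (sym (*-identityˡ _)) (*-congʳ (sym ιnat-1)))))
           (derivative-convolution n (f ∘ suc) g)) ⟩
    f 0 * dg (suc n) + ((df 0 * g (suc n) + C) + (convolution (derivative (f ∘ suc)) g n + convolution (f ∘ suc) dg n))
      ≈⟨ solve 5 (λ x y z u v → x :+ ((y :+ z) :+ (u :+ v)) := (y :+ (z :+ u)) :+ (x :+ v)) refl _ _ _ _ _ ⟩
    (df 0 * g (suc n) + (C + convolution (derivative (f ∘ suc)) g n)) + (f 0 * dg (suc n) + convolution (f ∘ suc) dg n)
      ≈⟨ +-congʳ (+-congˡ (trans (sym (convolution-+ˡ n (λ k → f (2 ℕ.+ k)) (derivative (f ∘ suc)) g))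
           (convolution-cong n shifted (λ _ → refl)))) ⟩
    (df 0 * g (suc n) + convolution (df ∘ suc) g n) + (f 0 * dg (suc n) + convolution (f ∘ suc) dg n) ∎
    where
    C = convolution (λ k → f (2 ℕ.+ k)) g n
    df = derivative f
    dg = derivative g
    shifted : ∀ k → f (2 ℕ.+ k) + derivative (f ∘ suc) k ≈ df (suc k)
    shifted k = trans (solve 2 (λ x m → x :+ m :* x := (:1 :+ m) :* x) refl _ _) (*-congʳ (sym (ιnat-suc (suc k))))

  -- Both sides satisfy F′ = (x + y) F with F(0) = 1, read coefficientwise as a recursion that
  -- determines F because n + 1 is invertible. The product rule takes the place of the binomial
  -- theorem.
  γ-+ : ∀ x y n → convolution (γ x) (γ y) n ≈ γ (x + y) n
  γ-+ x y zero = *-identityˡ 1#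
  γ-+ x y (suc n) = begin
    F (suc n)                              ≈⟨ *-identityˡ _ ⟨
    1# * F (suc n)                         ≈⟨ *-congʳ (ιnat*ιinv n) ⟨
    (ιnat (suc n) * ιinv n) * F (suc n)    ≈⟨ solve 3 (λ m i z → (m :* i) :* z := i :* (m :* z)) refl _ _ _ ⟩
    ιinv n * derivative F n                ≈⟨ *-congˡ (derivative-convolution n (γ x) (γ y)) ⟩
    ιinv n * (convolution (derivative (γ x)) (γ y) n + convolution (γ x) (derivative (γ y)) n)
      ≈⟨ *-congˡ (+-cong
           (trans (convolution-cong n (derivative-γ x) (λ _ → refl)) (convolution-*ˡ n x (γ x) (γ y)))
           (trans (convolution-cong n (λ _ → refl) (derivative-γ y)) (convolution-*ʳ n y (γ x) (γ y)))) ⟩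
    ιinv n * (x * F n + y * F n)           ≈⟨ solve 4 (λ i x y z → i :* (x :* z :+ y :* z) := (x :+ y) :* (i :* z)) refl _ _ _ _ ⟩
    (x + y) * (ιinv n * F n)               ≈⟨ *-congˡ (*-congˡ (γ-+ x y n)) ⟩
    (x + y) * (ιinv n * γ (x + y) n)       ∎
    where
    F = convolution (γ x) (γ y)

  exp : ℕ → Carrier → Carrier
  exp t x = partialSum t (γ x)

  -- Since x ^ p ≈ 0#, truncating the exponential series at p loses nothing.
  Exp : Carrier → Carrier → Set b
  Exp x y = ∃ λ p → x ^ p ≈ 0# × exp p x ≈ y

  Exp-truncation : ∀ {x y} ((p , _) : Exp x y) → ∀ t → exp (p ℕ.+ t) x ≈ y
  Exp-truncation (p , x^p≈0 , e) t = trans (partialSum-stable p t (γ-vanishes p x^p≈0)) e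

  Exp-cong : ∀ {x x′ y y′} → x ≈ x′ → y ≈ y′ → Exp x y → Exp x′ y′
  Exp-cong x≈x′ y≈y′ (p , z , e) = p , trans (^-congˡ p (sym x≈x′)) z ,
    trans (partialSum-cong p (λ k → γ-cong k (sym x≈x′))) (trans e y≈y′)

  Exp-unique : ∀ {x y y′} → Exp x y → Exp x y′ → y ≈ y′
  Exp-unique {x} E@(p , _) E′@(q , _) = trans (sym (Exp-truncation E q))
    (trans (reflexive (≡.cong (λ t → exp t x) (ℕₚ.+-comm p q))) (Exp-truncation E′ p))

  Exp-0 : Exp 0# 1#
  Exp-0 = 1 , *-identityʳ 0# , +-identityʳ 1#

  Exp-+ : ∀ {x x′ y y′} → Exp x y → Exp x′ y′ → Exp (x + x′) (y * y′)
  Exp-+ {x} {x′} E@(p , z , e) (q , z′ , e′) = p ℕ.+ q , ^-zero-+ p q z z′ , (begin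
    exp (p ℕ.+ q) (x + x′)                               ≈⟨ partialSum-cong (p ℕ.+ q) (λ n → sym (γ-+ x x′ n)) ⟩
    partialSum (p ℕ.+ q) (convolution (γ x) (γ x′))
      ≈⟨ partialSum-convolution p q (γ x) (γ x′) (γ-vanishes p z) (γ-vanishes q z′) ⟩
    exp (p ℕ.+ q) x * exp q x′                           ≈⟨ *-cong (Exp-truncation E q) e′ ⟩
    _ ∎)

  -- Lengthening the truncation by two terms changes nothing and exposes the terms 1 and x even when
  -- the given exponent is 0 or 1; all later terms are multiples of x².
  Exp-factor : ∀ {x y} → Exp x y → ∃ λ z → y ≈ 1# + x * (1# + x * z)
  Exp-factor {x} {y} E@(p , _ , _) = partialSum p δ , (begin
    y                            ≈⟨ Exp-truncation E 2 ⟨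
    exp (p ℕ.+ 2) x              ≡⟨ ≡.cong (λ t → exp t x) (ℕₚ.+-comm p 2) ⟩
    1# + (x * (ιinv 0 * 1#) + partialSum p (λ k → x * (ιinv (suc k) * (x * (ιinv k * γ x k)))))
      ≈⟨ +-congˡ (+-cong (*-congˡ (trans (*-identityʳ _) ιinv-0)) (trans
           (partialSum-cong p (λ k → solve 4 (λ x i j y → x :* (i :* (x :* (j :* y))) := (x :* x) :* (i :* (j :* y))) refl _ _ _ _))
           (partialSum-* p (x * x) δ))) ⟩
    1# + (x * 1# + (x * x) * partialSum p δ)
      ≈⟨ +-congˡ (solve 2 (λ x z → x :* :1 :+ (x :* x) :* z := x :* (:1 :+ x :* z)) refl _ _) ⟩
    1# + x * (1# + x * partialSum p δ) ∎)
    where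
    δ : ℕ → Carrier
    δ k = ιinv (suc k) * (ιinv k * γ x k)

  Exp-minus-1 : ∀ {x y} (E : Exp x y) → y - 1# ≈ x * (1# + x * proj₁ (Exp-factor E))
  Exp-minus-1 {x} {y} E = trans (+-congʳ (proj₂ (Exp-factor E))) (solve 1 (λ t → (:1 :+ t) :- :1 := t) refl (x * (1# + x * proj₁ (Exp-factor E))))

  Exp-power-zero : ∀ {x y} d → Exp x y → (y - 1#) ^ d ≈ 0# → x ^ d ≈ 0#
  Exp-power-zero {x} {y} d E e = cancel-unipotent {k = proj₁ E} (proj₁ (proj₂ E)) d
    (trans (^-congˡ d (sym (Exp-minus-1 E))) e)

  power-zero-Exp : ∀ {x y} d → Exp x y → x ^ d ≈ 0# → (y - 1#) ^ d ≈ 0#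
  power-zero-Exp {x} {y} d E e = trans (^-congˡ d (Exp-minus-1 E)) (^-zero-multiple d e)

  -- Newton iteration: replacing 1 + v by (1 + v) exp(-v) squares the order of v.
  private
    newton-step : ∀ v e z → e ≈ 1# + (- v) * (1# + (- v) * z) → (1# + v) * e - 1# ≈ (v * v) * ((z - 1#) + v * z)
    newton-step v e z e≈ = trans (+-congʳ (*-congˡ e≈))
      (solve 2 (λ v z → (:1 :+ v) :* (:1 :+ (:- v) :* (:1 :+ (:- v) :* z)) :- :1
                     := (v :* v) :* ((z :- :1) :+ v :* z)) refl v z)

    newton-recombine : ∀ v e e′ → e * e′ ≈ 1# → e * (1# + ((1# + v) * e′ - 1#)) ≈ 1# + v
    newton-recombine v e e′ inverse = begin
      e * (1# + ((1# + v) * e′ - 1#)) ≈⟨ solve 3 (λ a b v → a :* (:1 :+ ((:1 :+ v) :* b :- :1)) := (:1 :+ v) :* (a :* b)) refl e e′ v ⟩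
      (1# + v) * (e * e′)             ≈⟨ *-congˡ inverse ⟩
      (1# + v) * 1#                   ≈⟨ *-identityʳ _ ⟩
      1# + v                          ∎

    ^-zero-halve : ∀ n {v} → v ^ (2 ℕ.* n) ≈ 0# → (v * v) ^ n ≈ 0#
    ^-zero-halve n {v} e = begin
      (v * v) ^ n        ≈⟨ ^-distrib-* v v n ⟩
      v ^ n * v ^ n      ≈⟨ ^-homo-* v n n ⟨
      v ^ (n ℕ.+ n)      ≈⟨ ^-congʳ v (≡.cong (n ℕ.+_) (≡.sym (ℕₚ.+-identityʳ n))) ⟩
      v ^ (2 ℕ.* n)      ≈⟨ e ⟩
      0#                 ∎

    Exp-exists : ∀ p {v} → v ^ p ≈ 0# → Exp v (exp p v)
    Exp-exists p e = p , e , refl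

    log-2^ : ∀ s {v} → v ^ (2 ℕ.^ s) ≈ 0# → ∃ λ x → Exp x (1# + v)
    log-2^ zero {v} e = 0# , Exp-cong refl (trans (sym (+-identityʳ 1#)) (+-congˡ (sym (trans (sym (*-identityʳ v)) e)))) Exp-0
    log-2^ (suc s) {v} e = step (Exp-exists (2 ℕ.^ suc s) e)
      (Exp-exists (2 ℕ.^ suc s) (trans (^-congˡ (2 ℕ.^ suc s) (solve 1 (λ v → :- v := v :* (:- :1)) refl v))
        (^-zero-multiple (2 ℕ.^ suc s) e)))
      where
      step : ∀ {e⁺ e⁻} → Exp v e⁺ → Exp (- v) e⁻ → ∃ λ x → Exp x (1# + v)
      step {e⁺} {e⁻} E⁺ E⁻ = v + proj₁ rest , Exp-cong refl
        (newton-recombine v e⁺ e⁻ (Exp-unique (Exp-cong (-‿inverseʳ v) refl (Exp-+ E⁺ E⁻)) Exp-0))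
        (Exp-+ E⁺ (proj₂ rest))
        where
        rest : ∃ λ x → Exp x (1# + ((1# + v) * e⁻ - 1#))
        rest = log-2^ s (trans (^-congˡ (2 ℕ.^ s) (newton-step v e⁻ _ (proj₂ (Exp-factor E⁻))))
          (^-zero-multiple (2 ℕ.^ s) (^-zero-halve (2 ℕ.^ s) e)))

    n<2^n : ∀ n → n ℕ.< 2 ℕ.^ n
    n<2^n zero = ℕ.s≤s ℕ.z≤n
    n<2^n (suc n) = ℕₚ.≤-trans (ℕ.s≤s (n<2^n n))
      (ℕₚ.≤-trans (ℕₚ.+-monoˡ-≤ (2 ℕ.^ n) (ℕₚ.≤-trans (ℕ.s≤s ℕ.z≤n) (n<2^n n)))
        (ℕₚ.≤-reflexive (≡.cong (2 ℕ.^ n ℕ.+_) (≡.sym (ℕₚ.+-identityʳ (2 ℕ.^ n))))))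

  -- The exponent `k` is raised to 2^k, which exceeds it, because each Newton step halves the
  -- exponent.
  log : ∀ k {y} → (y - 1#) ^ k ≈ 0# → ∃ λ x → Exp x y
  log k {y} e = proj₁ logarithm , Exp-cong refl (solve 1 (λ y → :1 :+ (y :- :1) := y) refl y) (proj₂ logarithm)
    where
    logarithm : ∃ λ x → Exp x (1# + (y - 1#))
    logarithm = log-2^ k (trans (^-congʳ (y - 1#) (≡.sym (ℕₚ.m∸n+n≡m (ℕₚ.<⇒≤ (n<2^n k)))))
                  (^-annihilates-+ (y - 1#) (2 ℕ.^ k ℕ.∸ k) k e))

  Exp-sum : ∀ {n} {x y : Fin n → Carrier} → (∀ l → Exp (x l) (y l)) → Exp (sum x) (product y)
  Exp-sum {zero} E = Exp-0
  Exp-sum {suc n} E = Exp-+ (E zero) (Exp-sum (E ∘ suc))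

-- Free algebras, dual numbers and derivations.

module FreeAlgebra {c ℓ} (K : CommutativeRing c ℓ) where
  private module K = CommutativeRing K

  infixl 6 _⊕_
  infixl 7 _⊗_
  infix 4 _≈ₑ_

  -- A quotient of terms makes substitution and derivation structural recursions; the price is that
  -- maps out of it must be checked against every axiom in `_≈ₑ_`.
  data Expr (N : ℕ) : Set c where
    con : K.Carrier → Expr N
    var : Fin N → Expr N
    _⊕_ _⊗_ : Expr N → Expr N → Expr N

  data _≈ₑ_ {N} : Rel (Expr N) (c ⊔ ℓ) where
    ≈-refl   : ∀ {p} → p ≈ₑ p
    ≈-sym    : ∀ {p q} → p ≈ₑ q → q ≈ₑ p
    ≈-trans  : ∀ {p q r} → p ≈ₑ q → q ≈ₑ r → p ≈ₑ r
    ⊕-cong   : ∀ {p p′ q q′} → p ≈ₑ p′ → q ≈ₑ q′ → p ⊕ q ≈ₑ p′ ⊕ q′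
    ⊗-cong   : ∀ {p p′ q q′} → p ≈ₑ p′ → q ≈ₑ q′ → p ⊗ q ≈ₑ p′ ⊗ q′
    ⊕-assoc  : ∀ p q r → (p ⊕ q) ⊕ r ≈ₑ p ⊕ (q ⊕ r)
    ⊕-comm   : ∀ p q → p ⊕ q ≈ₑ q ⊕ p
    ⊕-idˡ    : ∀ p → con K.0# ⊕ p ≈ₑ p
    ⊕-invˡ   : ∀ p → (con (K.- K.1#) ⊗ p) ⊕ p ≈ₑ con K.0#
    ⊗-assoc  : ∀ p q r → (p ⊗ q) ⊗ r ≈ₑ p ⊗ (q ⊗ r)
    ⊗-comm   : ∀ p q → p ⊗ q ≈ₑ q ⊗ p
    ⊗-idˡ    : ∀ p → con K.1# ⊗ p ≈ₑ p
    ⊗-distˡ  : ∀ p q r → p ⊗ (q ⊕ r) ≈ₑ (p ⊗ q) ⊕ (p ⊗ r)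
    con-cong : ∀ {x y} → x K.≈ y → con x ≈ₑ con y
    con-+    : ∀ x y → con (x K.+ y) ≈ₑ con x ⊕ con y
    con-*    : ∀ x y → con (x K.* y) ≈ₑ con x ⊗ con y

  free : ℕ → KAlgebra K c (c ⊔ ℓ)
  free N = record
    { commutativeRing = makeCommutativeRing (_≈ₑ_ {N}) _⊕_ _⊗_ (con (K.- K.1#) ⊗_) (con K.0#) (con K.1#)
        (record { refl = ≈-refl ; sym = ≈-sym ; trans = ≈-trans })
        ⊕-cong ⊕-assoc ⊕-comm ⊕-idˡ (⊗-cong ≈-refl) ⊕-invˡ ⊗-cong ⊗-assoc ⊗-comm ⊗-idˡ ⊗-distˡ
    ; ι = con ; ι-cong = con-cong ; ι-+ = con-+ ; ι-* = con-* ; ι-1 = ≈-refl }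

  module _ {a b} (A : KAlgebra K a b) where
    open KAlgebra A

    lin : ∀ {N} → (Fin N → K.Carrier) → (Fin N → Carrier) → Carrier
    lin w ρ = sum (λ l → ι (w l) * ρ l)

    eval : ∀ {N} → (Fin N → Carrier) → Expr N → Carrier
    eval ρ (con x) = ι x
    eval ρ (var l) = ρ l
    eval ρ (p ⊕ q) = eval ρ p + eval ρ q
    eval ρ (p ⊗ q) = eval ρ p * eval ρ q

    eval-cong : ∀ {N} (ρ : Fin N → Carrier) {p q} → p ≈ₑ q → eval ρ p ≈ eval ρ q
    eval-cong ρ ≈-refl = refl
    eval-cong ρ (≈-sym e) = sym (eval-cong ρ e)
    eval-cong ρ (≈-trans e e′) = trans (eval-cong ρ e) (eval-cong ρ e′)
    eval-cong ρ (⊕-cong e e′) = +-cong (eval-cong ρ e) (eval-cong ρ e′)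
    eval-cong ρ (⊗-cong e e′) = *-cong (eval-cong ρ e) (eval-cong ρ e′)
    eval-cong ρ (⊕-assoc p q r) = +-assoc _ _ _
    eval-cong ρ (⊕-comm p q) = +-comm _ _
    eval-cong ρ (⊕-idˡ p) = trans (+-congʳ ι-0) (+-identityˡ _)
    eval-cong ρ (⊕-invˡ p) = trans (+-congʳ (*-congʳ (trans (ι-neg K.1#) (-‿cong ι-1))))
      (trans (solve 1 (λ x → (:- :1) :* x :+ x := :0) refl _) (sym ι-0))
    eval-cong ρ (⊗-assoc p q r) = *-assoc _ _ _
    eval-cong ρ (⊗-comm p q) = *-comm _ _
    eval-cong ρ (⊗-idˡ p) = trans (*-congʳ ι-1) (*-identityˡ _)
    eval-cong ρ (⊗-distˡ p q r) = distribˡ _ _ _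
    eval-cong ρ (con-cong e) = ι-cong e
    eval-cong ρ (con-+ x y) = ι-+ x y
    eval-cong ρ (con-* x y) = ι-* x y

    eval-pointwise : ∀ {N} {ρ ρ′ : Fin N → Carrier} → (∀ l → ρ l ≈ ρ′ l) → ∀ p → eval ρ p ≈ eval ρ′ p
    eval-pointwise e (con x) = refl
    eval-pointwise e (var l) = e l
    eval-pointwise e (p ⊕ q) = +-cong (eval-pointwise e p) (eval-pointwise e q)
    eval-pointwise e (p ⊗ q) = *-cong (eval-pointwise e p) (eval-pointwise e q)

    module _ {N} (ρ : Fin N → Carrier) where
      private module E = KAlgebra (free N)

      eval-^ : ∀ p k → eval ρ (p E.^ k) ≈ eval ρ p ^ k
      eval-^ p zero = ι-1
      eval-^ p (suc k) = *-congˡ (eval-^ p k)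

      eval-sum : ∀ {M} (f : Fin M → Expr N) → eval ρ (E.sum f) ≈ sum (λ l → eval ρ (f l))
      eval-sum {zero} f = ι-0
      eval-sum {suc M} f = +-congˡ (eval-sum (f ∘ suc))

      eval-product : ∀ {M} (f : Fin M → Expr N) → eval ρ (E.product f) ≈ product (λ l → eval ρ (f l))
      eval-product {zero} f = ι-1
      eval-product {suc M} f = *-congˡ (eval-product (f ∘ suc))

      eval-neg : ∀ p → eval ρ (E.- p) ≈ - eval ρ p
      eval-neg p = trans (*-congʳ (trans (ι-neg K.1#) (-‿cong ι-1)))
        (solve 1 (λ x → (:- :1) :* x := :- x) refl _)

  eval-substitute : ∀ {a b} (A : KAlgebra K a b) {M N} (ρ : Fin N → KAlgebra.Carrier A) (σ : Fin M → Expr N) p →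
    KAlgebra._≈_ A (eval A ρ (eval (free N) σ p)) (eval A (λ l → eval A ρ (σ l)) p)
  eval-substitute A ρ σ (con x) = KAlgebra.refl A
  eval-substitute A ρ σ (var l) = KAlgebra.refl A
  eval-substitute A ρ σ (p ⊕ q) = KAlgebra.+-cong A (eval-substitute A ρ σ p) (eval-substitute A ρ σ q)
  eval-substitute A ρ σ (p ⊗ q) = KAlgebra.*-cong A (eval-substitute A ρ σ p) (eval-substitute A ρ σ q)

  eval-var : ∀ {N} (p : Expr N) → eval (free N) var p ≡ p
  eval-var (con x) = ≡.refl
  eval-var (var l) = ≡.refl
  eval-var (p ⊕ q) = ≡.cong₂ _⊕_ (eval-var p) (eval-var q)
  eval-var (p ⊗ q) = ≡.cong₂ _⊗_ (eval-var p) (eval-var q)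

  dual : ∀ {a b} → KAlgebra K a b → KAlgebra K a b
  dual A = record
    { commutativeRing = makeCommutativeRing
        (λ { (x , x′) (y , y′) → x ≈ y × x′ ≈ y′ })
        (λ { (x , x′) (y , y′) → x + y , x′ + y′ })
        (λ { (x , x′) (y , y′) → x * y , x * y′ + x′ * y })
        (λ { (x , x′) → - x , - x′ }) (0# , 0#) (1# , 0#)
        (record { refl = refl , refl ; sym = λ { (e , e′) → sym e , sym e′ }
                ; trans = λ { (e , e′) (f , f′) → trans e f , trans e′ f′ } })
        (λ { (e , e′) (f , f′) → +-cong e f , +-cong e′ f′ })
        (λ _ _ _ → +-assoc _ _ _ , +-assoc _ _ _)
        (λ _ _ → +-comm _ _ , +-comm _ _)
        (λ _ → +-identityˡ _ , +-identityˡ _)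
        (λ { (e , e′) → -‿cong e , -‿cong e′ })
        (λ _ → -‿inverseˡ _ , -‿inverseˡ _)
        (λ { (e , e′) (f , f′) → *-cong e f , +-cong (*-cong e f′) (*-cong e′ f) })
        (λ { (x , x′) (y , y′) (z , z′) → *-assoc x y z ,
          solve 6 (λ x x′ y y′ z z′ → (x :* y) :* z′ :+ (x :* y′ :+ x′ :* y) :* z
                                   := x :* (y :* z′ :+ y′ :* z) :+ x′ :* (y :* z)) refl x x′ y y′ z z′ })
        (λ { (x , x′) (y , y′) → *-comm x y ,
          solve 4 (λ x x′ y y′ → x :* y′ :+ x′ :* y := y :* x′ :+ y′ :* x) refl x x′ y y′ })
        (λ { (x , x′) → *-identityˡ x , solve 2 (λ x x′ → :1 :* x′ :+ :0 :* x := x′) refl x x′ })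
        (λ { (x , x′) (y , y′) (z , z′) → distribˡ x y z ,
          solve 6 (λ x x′ y y′ z z′ → x :* (y′ :+ z′) :+ x′ :* (y :+ z)
                                   := (x :* y′ :+ x′ :* y) :+ (x :* z′ :+ x′ :* z)) refl x x′ y y′ z z′ })
    ; ι = λ x → ι x , 0#
    ; ι-cong = λ e → ι-cong e , refl
    ; ι-+ = λ x y → ι-+ x y , sym (+-identityˡ 0#)
    ; ι-* = λ x y → ι-* x y , solve 2 (λ x y → :0 := x :* :0 :+ :0 :* y) refl (ι x) (ι y)
    ; ι-1 = ι-1 , refl }
    where
    open KAlgebra A

  module _ {a b} (A : KAlgebra K a b) where
    open KAlgebra A
    private module D = KAlgebra (dual A)

    dual-power : ∀ x x′ k → ∃ λ z → (x , x′) D.^ suc k D.≈ (x ^ suc k , x ^ k * z)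
    dual-power x x′ zero = x′ , refl , solve 2 (λ x x′ → x :* :0 :+ x′ :* :1 := :1 :* x′) refl x x′
    dual-power x x′ (suc k) = proj₁ rest + x′ ,
      D.trans (D.*-congˡ (proj₂ rest)) (refl ,
        solve 4 (λ x x′ y z → x :* (y :* z) :+ x′ :* (x :* y) := (x :* y) :* (z :+ x′)) refl x x′ (x ^ k) (proj₁ rest))
      where rest = dual-power x x′ k

    -- The ε-part of (x + ε x′)^(k + 1) is a multiple of x^k, so one further power suffices whatever
    -- `x′` is. This is how an edge crossing the cut adds one to the exponent D_I + 1.
    dual-power-suc : ∀ {x x′} k → x ^ k ≈ 0# → (x , x′) D.^ suc k D.≈ D.0#
    dual-power-suc {x} {x′} k e = D.trans (proj₂ (dual-power x x′ k))
      (trans (*-congˡ e) (zeroʳ x) , trans (*-congʳ e) (zeroˡ _))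

    ^-scalar : ∀ x k → (x , 0#) D.^ k D.≈ (x ^ k , 0#)
    ^-scalar x zero = D.refl
    ^-scalar x (suc k) = D.trans (D.*-congˡ (^-scalar x k)) (refl , solve 2 (λ x y → x :* :0 :+ :0 :* y := :0) refl x (x ^ k))

    dual-power-scalar : ∀ {x x′} k → x′ ≈ 0# → x ^ k ≈ 0# → (x , x′) D.^ k D.≈ D.0#
    dual-power-scalar {x} k x′≈0 e = D.trans (D.^-congˡ k (refl , x′≈0)) (D.trans (^-scalar x k) (e , refl))

    dual-sum : ∀ {M} (f f′ : Fin M → Carrier) → D.sum (λ l → f l , f′ l) D.≈ (sum f , sum f′)
    dual-sum {zero} f f′ = D.refl
    dual-sum {suc M} f f′ = D.+-congˡ (dual-sum (f ∘ suc) (f′ ∘ suc))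

    dual-lin : ∀ {N} w (ρ ρ′ : Fin N → Carrier) → lin (dual A) w (λ l → ρ l , ρ′ l) D.≈ (lin A w ρ , lin A w ρ′)
    dual-lin w ρ ρ′ = D.trans (D.sum-cong-≋ (λ l → refl , solve 2 (λ x y → x :+ :0 :* y := x) refl (ι (w l) * ρ′ l) (ρ l)))
      (dual-sum (λ l → ι (w l) * ρ l) (λ l → ι (w l) * ρ′ l))

  -- The summands of the product rule are ordered as in the product of `dual`, so that the inductive
  -- cases of `eval-dual` hold by congruence alone.
  ∂ : ∀ {N} → (Fin N → K.Carrier) → Expr N → Expr N
  ∂ c (con x) = con K.0#
  ∂ c (var l) = con (c l)
  ∂ c (p ⊕ q) = ∂ c p ⊕ ∂ c q
  ∂ c (p ⊗ q) = p ⊗ ∂ c q ⊕ ∂ c p ⊗ q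

  eval-dual : ∀ {a b} (A : KAlgebra K a b) {N} (ρ : Fin N → KAlgebra.Carrier A) c p →
    KAlgebra._≈_ (dual A) (eval (dual A) (λ l → ρ l , KAlgebra.ι A (c l)) p) (eval A ρ p , eval A ρ (∂ c p))
  eval-dual A ρ c (con x) = KAlgebra.refl A , KAlgebra.sym A (KAlgebra.ι-0 A)
  eval-dual A ρ c (var l) = KAlgebra.refl (dual A)
  eval-dual A ρ c (p ⊕ q) = KAlgebra.+-cong (dual A) (eval-dual A ρ c p) (eval-dual A ρ c q)
  eval-dual A ρ c (p ⊗ q) = KAlgebra.*-cong (dual A) (eval-dual A ρ c p) (eval-dual A ρ c q)

  -- Well-definedness of ∂ is read off from evaluation in the dual numbers over the free algebra.
  ∂-cong : ∀ {N} c {p q : Expr N} → p ≈ₑ q → ∂ c p ≈ₑ ∂ c q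
  ∂-cong {N} c {p} {q} e = ≡.subst₂ _≈ₑ_ (eval-var (∂ c p)) (eval-var (∂ c q))
    (≈-trans (≈-sym (proj₂ (eval-dual (free N) var c p)))
      (≈-trans (proj₂ (eval-cong (dual (free N)) (λ l → var l , con (c l)) e)) (proj₂ (eval-dual (free N) var c q))))

-- The additive theorem by deletion and contraction.

module AdditiveTheorem {c ℓ} (K : CommutativeRing c ℓ) (inv : ℕ → CommutativeRing.Carrier K)
  (inv-correct : ∀ k → CommutativeRing._≈_ K (CommutativeRing._*_ K (natK K (suc k)) (inv k)) (CommutativeRing.1# K))
  where
  private module K = CommutativeRing K
  open FreeAlgebra K

  module Derivation {N} (w : Fin N → K.Carrier) where
    open KAlgebra (free N)
    open Exponential K inv inv-correct (free N) using (ιnat; ιinv; ιnat*ιinv; ιnat-suc; ιnat-1; ιnat-cancel)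
    open ≈-Reasoning

    d : Expr N → Expr N
    d = ∂ w

    d-cong : ∀ {p q} → p ≈ q → d p ≈ d q
    d-cong = ∂-cong w

    d-con* : ∀ x p → d (con x * p) ≈ con x * d p
    d-con* x p = trans (+-congˡ (zeroˡ p)) (+-identityʳ _)

    d-sum : ∀ {M} (f : Fin M → Expr N) → d (sum f) ≈ sum (d ∘ f)
    d-sum {zero} f = refl
    d-sum {suc M} f = +-congˡ (d-sum (f ∘ suc))

    d-lin : ∀ v → d (lin (free N) v var) ≈ lin (free N) v (con ∘ w)
    d-lin v = trans (d-sum (λ l → con (v l) * var l)) (sum-cong-≋ (λ l → d-con* (v l) (var l)))

    d-^ : ∀ {u s} → d u ≈ con s → ∀ k → d (u ^ suc k) ≈ (ιnat (suc k) * con s) * u ^ k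
    d-^ {u} {s} e zero = begin
      u * con K.0# + d u * 1#      ≈⟨ +-congˡ (*-congʳ e) ⟩
      u * con K.0# + con s * 1#    ≈⟨ solve 2 (λ u s → u :* :0 :+ s :* :1 := (:1 :* s) :* :1) refl u (con s) ⟩
      (1# * con s) * 1#            ≈⟨ *-congʳ (*-congʳ ιnat-1) ⟨
      (ιnat 1 * con s) * 1#        ∎
    d-^ {u} {s} e (suc k) = begin
      u * d (u ^ suc k) + d u * u ^ suc k
        ≈⟨ +-cong (*-congˡ (d-^ e k)) (*-congʳ e) ⟩
      u * ((ιnat (suc k) * con s) * u ^ k) + con s * (u * u ^ k)
        ≈⟨ solve 4 (λ u n s y → u :* ((n :* s) :* y) :+ s :* (u :* y) := ((:1 :+ n) :* s) :* (u :* y)) refl u _ (con s) (u ^ k) ⟩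
      ((1# + ιnat (suc k)) * con s) * u ^ suc k
        ≈⟨ *-congʳ (*-congʳ (ιnat-suc (suc k))) ⟨
      (ιnat (2 ℕ.+ k) * con s) * u ^ suc k ∎

    d^ : ℕ → Expr N → Expr N
    d^ zero p = p
    d^ (suc k) p = d^ k (d p)

    d^-cong : ∀ k {p q} → p ≈ q → d^ k p ≈ d^ k q
    d^-cong zero e = e
    d^-cong (suc k) e = d^-cong k (d-cong e)

    d^-+ : ∀ k p q → d^ k (p + q) ≈ d^ k p + d^ k q
    d^-+ zero p q = refl
    d^-+ (suc k) p q = d^-+ k (d p) (d q)

    d^-0 : ∀ k → d^ k 0# ≈ 0#
    d^-0 zero = refl
    d^-0 (suc k) = d^-0 k

    d^-vanishes-+ : ∀ j k {p} → d^ j p ≈ 0# → d^ (j ℕ.+ k) p ≈ 0#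
    d^-vanishes-+ zero k e = trans (d^-cong k e) (d^-0 k)
    d^-vanishes-+ (suc j) k e = d^-vanishes-+ j k e

    -- By the Leibniz rule each application of `d` falls on one of the two factors; after `j + k` of
    -- them one factor has received its full share.
    d^-vanishes-* : ∀ j k {p q} → d^ j p ≈ 0# → d^ k q ≈ 0# → d^ (j ℕ.+ k) (p * q) ≈ 0#
    d^-vanishes-* zero k {p} {q} e f = trans (d^-cong k (trans (*-congʳ e) (zeroˡ q))) (d^-0 k)
    d^-vanishes-* (suc j) zero {p} {q} e f =
      trans (d^-cong (suc j ℕ.+ 0) (trans (*-congˡ f) (zeroʳ p))) (d^-0 (suc j ℕ.+ 0))
    d^-vanishes-* (suc j) (suc k) {p} {q} e f = begin
      d^ (j ℕ.+ suc k) (p * d q + d p * q)                     ≈⟨ d^-+ (j ℕ.+ suc k) (p * d q) (d p * q) ⟩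
      d^ (j ℕ.+ suc k) (p * d q) + d^ (j ℕ.+ suc k) (d p * q)
        ≈⟨ +-cong (trans (reflexive (≡.cong (λ t → d^ t (p * d q)) (ℕₚ.+-suc j k))) (d^-vanishes-* (suc j) k e f))
                  (d^-vanishes-* j (suc k) e f) ⟩
      0# + 0#                                                  ≈⟨ +-identityˡ 0# ⟩
      0#                                                       ∎

    -- Variables go to constants and constants to zero, and the property passes to sums and
    -- products.
    locally-nilpotent : ∀ p → ∃ λ k → d^ k p ≈ 0#
    locally-nilpotent (con x) = 1 , refl
    locally-nilpotent (var l) = 2 , refl
    locally-nilpotent (p ⊕ q) = j ℕ.+ k ,
      trans (d^-+ (j ℕ.+ k) p q) (trans (+-cong (d^-vanishes-+ j k e)
        (trans (reflexive (≡.cong (λ t → d^ t q) (ℕₚ.+-comm j k))) (d^-vanishes-+ k j f))) (+-identityˡ 0#))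
      where
      j = proj₁ (locally-nilpotent p)
      k = proj₁ (locally-nilpotent q)
      e = proj₂ (locally-nilpotent p)
      f = proj₂ (locally-nilpotent q)
    locally-nilpotent (p ⊗ q) = proj₁ (locally-nilpotent p) ℕ.+ proj₁ (locally-nilpotent q) ,
      d^-vanishes-* (proj₁ (locally-nilpotent p)) (proj₁ (locally-nilpotent q)) {p} {q} (proj₂ (locally-nilpotent p)) (proj₂ (locally-nilpotent q))

    -- Repeated integration by parts, which ends because d is locally nilpotent.
    antiderivative-power : ∀ {u s t} → d u ≈ con s → con s * con t ≈ 1# →
      ∀ h n → ∃ λ g → d (g * u ^ suc n) ≈ h * u ^ n
    antiderivative-power {u} {s} {t} du st≈1 h n = go (proj₁ (locally-nilpotent h)) h n (proj₂ (locally-nilpotent h))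
      where
      go : ∀ k h n → d^ k h ≈ 0# → ∃ λ g → d (g * u ^ suc n) ≈ h * u ^ n
      go zero h n e = 0# , trans (d-cong (zeroˡ (u ^ suc n))) (sym (trans (*-congʳ e) (zeroˡ (u ^ n))))
      -- Here κ = 1 / ((n + 1) s), and g′ solves the same problem for `d h` with `n` raised by one:
      -- the antiderivative of h u^n is κ (h u^(n + 1) - g′ u^(n + 2)).
      go (suc k) h n e = κ * (h - g′ * u) , (begin
        d ((κ * (h - g′ * u)) * u ^ suc n)
          ≈⟨ d-cong (solve 4 (λ κ h g v → (κ :* (h :- g)) :* v := κ :* (h :* v :- g :* v)) refl κ h (g′ * u) (u ^ suc n)) ⟩
        d (κ * (h * u ^ suc n - (g′ * u) * u ^ suc n))
          ≈⟨ d-con* _ _ ⟩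
        κ * (d (h * u ^ suc n) + d (- ((g′ * u) * u ^ suc n)))
          ≈⟨ *-congˡ (+-congˡ (trans (d-con* _ _) (*-congˡ (trans (d-cong (*-assoc g′ u (u ^ suc n))) (proj₂ rest))))) ⟩
        κ * ((h * d (u ^ suc n) + d h * u ^ suc n) - d h * u ^ suc n)
          ≈⟨ *-congˡ (+-congʳ (+-congʳ (*-congˡ (d-^ du n)))) ⟩
        κ * ((h * ((ιnat (suc n) * con s) * u ^ n) + d h * u ^ suc n) - d h * u ^ suc n)
          ≈⟨ solve 6 (λ κ h m s v y → κ :* ((h :* ((m :* s) :* v) :+ y) :- y) := (κ :* (m :* s)) :* (h :* v))
               refl κ h (ιnat (suc n)) (con s) (u ^ n) (d h * u ^ suc n) ⟩
        (κ * (ιnat (suc n) * con s)) * (h * u ^ n)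
          ≈⟨ *-congʳ κ-inverse ⟩
        1# * (h * u ^ n) ≈⟨ *-identityˡ _ ⟩
        h * u ^ n ∎)
        where
        rest = go k (d h) (suc n) e
        g′ = proj₁ rest
        κ = con (inv n K.* t)
        κ-inverse : κ * (ιnat (suc n) * con s) ≈ 1#
        κ-inverse = begin
          κ * (ιnat (suc n) * con s) ≈⟨ *-congʳ (con-* _ _) ⟩
          (ιinv n * con t) * (ιnat (suc n) * con s)
            ≈⟨ solve 4 (λ i t m s → (i :* t) :* (m :* s) := (m :* i) :* (s :* t)) refl (ιinv n) (con t) (ιnat (suc n)) (con s) ⟩
          (ιnat (suc n) * ιinv n) * (con s * con t) ≈⟨ *-cong (ιnat*ιinv n) st≈1 ⟩
          1# * 1# ≈⟨ *-identityˡ 1# ⟩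
          1# ∎

    antiderivative : ∀ {u} → d u ≈ con K.1# → ∀ h → ∃ λ g → d g ≈ h
    antiderivative {u} du h = proj₁ G * u ^ 1 , trans (proj₂ G) (*-identityʳ h)
      where G = antiderivative-power {u} {K.1#} {K.1#} du (*-identityˡ 1#) h 0

    -- Applying d to the eigenvalue equation gives the equation for d v with n replaced by n + 1.
    eigen-zero : ∀ {u} → d u ≈ - 1# → ∀ k n v → d^ k v ≈ 0# → ιnat (suc n) * v ≈ u * d v → v ≈ 0#
    eigen-zero du zero n v e _ = e
    eigen-zero {u} du (suc k) n v e eigen = ιnat-cancel n (trans eigen (trans (*-congˡ dv≈0) (zeroʳ u)))
      where
      dv≈0 : d v ≈ 0#
      dv≈0 = eigen-zero du k (suc n) (d v) e (begin
        ιnat (2 ℕ.+ n) * d v            ≈⟨ *-congʳ (ιnat-suc (suc n)) ⟩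
        (1# + ιnat (suc n)) * d v       ≈⟨ solve 2 (λ m y → (:1 :+ m) :* y := m :* y :+ y) refl (ιnat (suc n)) (d v) ⟩
        ιnat (suc n) * d v + d v        ≈⟨ +-congʳ (trans (sym (d-con* _ v)) (d-cong eigen)) ⟩
        (u * d (d v) + d u * d v) + d v ≈⟨ +-congʳ (+-congˡ (*-congʳ du)) ⟩
        (u * d (d v) + (- 1#) * d v) + d v ≈⟨ solve 2 (λ y z → (z :+ (:- :1) :* y) :+ y := z) refl (d v) (u * d (d v)) ⟩
        u * d (d v) ∎)

    module _ (j : Fin N) (wj≈-1 : w j K.≈ K.- K.1#) where
      -- The Taylor shift exp(x_j d), the projection onto the kernel of d.
      retract : Fin N → Expr N
      retract l = var l ⊕ con (w l) ⊗ var j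

      private
        σ : Expr N → Expr N
        σ = eval (free N) retract

        du≈-1 : d (var j) ≈ - 1#
        du≈-1 = trans (con-cong wj≈-1) (trans (ι-neg K.1#) refl)

      d-retract : ∀ p → d (σ p) ≈ 0#
      d-retract (con x) = refl
      d-retract (var l) = begin
        con (w l) + (con (w l) * con (w j) + con K.0# * var j)  ≈⟨ +-congˡ (+-congʳ (*-congˡ du≈-1)) ⟩
        con (w l) + (con (w l) * - 1# + 0# * var j)
          ≈⟨ solve 2 (λ x y → x :+ (x :* (:- :1) :+ :0 :* y) := :0) refl (con (w l)) (var j) ⟩
        0# ∎
      d-retract (p ⊕ q) = trans (+-cong (d-retract p) (d-retract q)) (+-identityˡ 0#)
      d-retract (p ⊗ q) = trans (+-cong (*-congˡ (d-retract q)) (*-congʳ (d-retract p)))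
        (solve 2 (λ x y → x :* :0 :+ :0 :* y := :0) refl (σ p) (σ q))

      -- The substitution fixes every variable modulo x_j, hence every polynomial.
      retract-remainder : ∀ p → ∃ λ v → p ≈ σ p + var j * v
      retract-remainder (con x) = 0# , solve 2 (λ x y → x := x :+ y :* :0) refl (con x) (var j)
      retract-remainder (var l) = - con (w l) ,
        solve 3 (λ x y z → x := (x :+ z :* y) :+ y :* (:- z)) refl (var l) (var j) (con (w l))
      retract-remainder (p ⊕ q) = proj₁ P + proj₁ Q , trans (+-cong (proj₂ P) (proj₂ Q))
        (solve 5 (λ p q u x y → (p :+ u :* x) :+ (q :+ u :* y) := (p :+ q) :+ u :* (x :+ y)) refl (σ p) (σ q) (var j) (proj₁ P) (proj₁ Q))
        where
        P = retract-remainder p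
        Q = retract-remainder q
      retract-remainder (p ⊗ q) = σ p * proj₁ Q + (proj₁ P * σ q + var j * (proj₁ P * proj₁ Q)) , trans (*-cong (proj₂ P) (proj₂ Q))
        (solve 5 (λ p q u x y → (p :+ u :* x) :* (q :+ u :* y) := (p :* q) :+ u :* (p :* y :+ (x :* q :+ u :* (x :* y))))
          refl (σ p) (σ q) (var j) (proj₁ P) (proj₁ Q))
        where
        P = retract-remainder p
        Q = retract-remainder q

      -- Write p = σ p + x_j v; then d (x_j v) = 0 reads v = x_j · d v.
      kernel-retract : ∀ p → d p ≈ 0# → p ≈ σ p
      kernel-retract p dp≈0 = trans (proj₂ R) (trans (+-congˡ (trans (*-congˡ v≈0) (zeroʳ (var j)))) (+-identityʳ (σ p)))
        where
        R = retract-remainder p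
        v = proj₁ R
        v≈0 : v ≈ 0#
        v≈0 = eigen-zero du≈-1 (proj₁ (locally-nilpotent v)) 0 v (proj₂ (locally-nilpotent v)) (begin
          ιnat 1 * v ≈⟨ *-congʳ ιnat-1 ⟩
          1# * v ≈⟨ solve 3 (λ u v y → :1 :* v := u :* y :- (:0 :+ (u :* y :+ (:- :1) :* v))) refl (var j) v (d v) ⟩
          var j * d v - (0# + (var j * d v + (- 1#) * v))
            ≈⟨ +-congˡ (-‿cong (+-cong (d-retract p) (+-congˡ (*-congʳ du≈-1)))) ⟨
          var j * d v - d (σ p + var j * v) ≈⟨ +-congˡ (-‿cong (trans (sym (d-cong (proj₂ R))) dp≈0)) ⟩
          var j * d v - 0# ≈⟨ solve 1 (λ x → x :- :0 := x) refl (var j * d v) ⟩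
          var j * d v ∎)

  -- A pair with equal ends is a loop: its `incidence` vanishes and it crosses no cut, so the kernel
  -- and the ideal are the same with and without it.
  Edges : ℕ → ℕ → Set
  Edges N m = Fin m → Fin N × Fin N

  cut : ∀ {N m} → Edges N m → (Fin N → Bool) → ℕ
  cut {m = zero} es f = 0
  cut {m = suc m} es f = (if f (proj₁ (es zero)) xor f (proj₂ (es zero)) then 1 else 0) ℕ.+ cut (es ∘ suc) f

  δ : ∀ {N} → Fin N → Fin N → K.Carrier
  δ i l = if does (l Fin.≟ i) then K.1# else K.0#

  incidence : ∀ {N} → Fin N × Fin N → Fin N → K.Carrier
  incidence (i , j) l = δ i l K.- δ j l

  ⟨_⟩ : Bool → K.Carrier
  ⟨ b ⟩ = if b then K.1# else K.0#

  -- Φ_G for a graph with m edges: adjoining φ_e with φ_e² = 0 means passing to dual numbers.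
  tower : ℕ → KAlgebra K c ℓ
  tower zero = record
    { commutativeRing = K ; ι = λ x → x ; ι-cong = λ e → e
    ; ι-+ = λ _ _ → K.refl ; ι-* = λ _ _ → K.refl ; ι-1 = K.refl }
  tower (suc m) = dual (tower m)

  X : ∀ {N m} → Edges N m → Fin N → KAlgebra.Carrier (tower m)
  X {m = zero} es l = K.0#
  X {m = suc m} es l = X (es ∘ suc) l , KAlgebra.ι (tower m) (incidence (es zero) l)

  Vanishes : ∀ {N m} → Edges N m → Expr N → Set ℓ
  Vanishes {m = m} es p = KAlgebra._≈_ (tower m) (eval (tower m) (X es) p) (KAlgebra.0# (tower m))

  -- The vertex set I of a generator is given by its indicator f; I = ∅ is allowed, with generator 0.
  data _∈I_ {N m} : Expr N → Edges N m → Set (c ⊔ ℓ) where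
    generator : ∀ {es} h f →
      (h ⊗ KAlgebra._^_ (free N) (lin (free N) (⟨_⟩ ∘ f) var) (suc (cut es f))) ∈I es
    0∈I       : ∀ {es} → con K.0# ∈I es
    +∈I       : ∀ {es p q} → p ∈I es → q ∈I es → (p ⊕ q) ∈I es
    ≈∈I       : ∀ {es p q} → p ≈ₑ q → p ∈I es → q ∈I es

  *∈I : ∀ {N m} {es : Edges N m} h {p} → p ∈I es → (h ⊗ p) ∈I es
  *∈I h (generator h′ f) = ≈∈I (⊗-assoc h h′ _) (generator (h ⊗ h′) f)
  *∈I {N} h 0∈I = ≈∈I (≈-sym (KAlgebra.zeroʳ (free N) h)) 0∈I
  *∈I h (+∈I p q) = ≈∈I (≈-sym (⊗-distˡ h _ _)) (+∈I (*∈I h p) (*∈I h q))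
  *∈I h (≈∈I e p) = ≈∈I (⊗-cong ≈-refl e) (*∈I h p)

  module _ {a b} (A : KAlgebra K a b) where
    open KAlgebra A
    open ≈-Reasoning

    ι-⟨⟩ : ∀ b x → ι ⟨ b ⟩ * x ≈ (if b then x else 0#)
    ι-⟨⟩ true x = trans (*-congʳ ι-1) (*-identityˡ x)
    ι-⟨⟩ false x = trans (*-congʳ ι-0) (zeroˡ x)

    lin-δ : ∀ {N} (w : Fin N → K.Carrier) i → lin A w (λ l → ι (δ i l)) ≈ ι (w i)
    lin-δ w i = trans (sum-cong-≋ (λ l → trans (*-comm (ι (w l)) (ι (δ i l))) (ι-⟨⟩ (does (l Fin.≟ i)) (ι (w l)))))
      (sum-single (λ l → ι (w l)) i)

    lin-+ : ∀ {N} (w : Fin N → K.Carrier) ρ ρ′ → lin A w (λ l → ρ l + ρ′ l) ≈ lin A w ρ + lin A w ρ′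
    lin-+ w ρ ρ′ = trans (sum-cong-≋ (λ l → distribˡ (ι (w l)) (ρ l) (ρ′ l)))
      (∑-distrib-+ (λ l → ι (w l) * ρ l) (λ l → ι (w l) * ρ′ l))

    lin-* : ∀ {N} (w : Fin N → K.Carrier) ρ x → lin A w (λ l → ρ l * x) ≈ lin A w ρ * x
    lin-* w ρ x = trans (sum-cong-≋ (λ l → sym (*-assoc (ι (w l)) (ρ l) x))) (sym (*-distribʳ-sum x (λ l → ι (w l) * ρ l)))

    lin-cong : ∀ {N} {w w′ : Fin N → K.Carrier} {ρ ρ′} → (∀ l → w l K.≈ w′ l) → (∀ l → ρ l ≈ ρ′ l) → lin A w ρ ≈ lin A w′ ρ′
    lin-cong e f = sum-cong-≋ (λ l → *-cong (ι-cong (e l)) (f l))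

    lin-incidence : ∀ {N} (w : Fin N → K.Carrier) i j → lin A w (λ l → ι (incidence (i , j) l)) ≈ ι (w i) - ι (w j)
    lin-incidence w i j = begin
      lin A w (λ l → ι (δ i l K.- δ j l))
        ≈⟨ lin-cong (λ _ → K.refl) (λ l → trans (ι-+ (δ i l) _) (+-congˡ (trans (ι-neg (δ j l)) (minus (ι (δ j l)))))) ⟩
      lin A w (λ l → ι (δ i l) + ι (δ j l) * - 1#)
        ≈⟨ lin-+ w (λ l → ι (δ i l)) (λ l → ι (δ j l) * - 1#) ⟩
      lin A w (λ l → ι (δ i l)) + lin A w (λ l → ι (δ j l) * - 1#)
        ≈⟨ +-cong (lin-δ w i) (trans (lin-* w (λ l → ι (δ j l)) (- 1#)) (*-congʳ (lin-δ w j))) ⟩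
      ι (w i) + ι (w j) * - 1# ≈⟨ +-congˡ (minus (ι (w j))) ⟨
      ι (w i) - ι (w j) ∎
      where
      minus : ∀ x → - x ≈ x * - 1#
      minus = solve 1 (λ x → :- x := x :* (:- :1)) refl

    eval-lin : ∀ {N} (ρ : Fin N → Carrier) w → eval A ρ (lin (free N) w var) ≈ lin A w ρ
    eval-lin ρ w = eval-sum A ρ (λ l → con (w l) ⊗ var l)

    ∈I-vanishes : ∀ {N m} {es : Edges N m} (ρ : Fin N → Carrier) →
      (∀ f → lin A (⟨_⟩ ∘ f) ρ ^ suc (cut es f) ≈ 0#) → ∀ {p} → p ∈I es → eval A ρ p ≈ 0#
    ∈I-vanishes {N} {es = es} ρ H (generator h f) = trans (*-congˡ
      (trans (eval-^ A ρ (lin (free N) (⟨_⟩ ∘ f) var) (suc (cut es f)))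
        (trans (^-congˡ (suc (cut es f)) (eval-lin ρ (⟨_⟩ ∘ f))) (H f)))) (zeroʳ _)
    ∈I-vanishes ρ H 0∈I = ι-0
    ∈I-vanishes ρ H (+∈I p q) = trans (+-cong (∈I-vanishes ρ H p) (∈I-vanishes ρ H q)) (+-identityˡ 0#)
    ∈I-vanishes ρ H (≈∈I e p) = trans (sym (eval-cong A ρ e)) (∈I-vanishes ρ H p)

    dual-power-cut : ∀ b b′ {x x′} k → x′ ≈ ι ⟨ b ⟩ - ι ⟨ b′ ⟩ → x ^ suc k ≈ 0# →
      KAlgebra._≈_ (dual A) (KAlgebra._^_ (dual A) (x , x′) (suc ((if b xor b′ then 1 else 0) ℕ.+ k))) (0# , 0#)
    dual-power-cut true true k e z = dual-power-scalar A (suc k) (trans e (-‿inverseʳ _)) z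
    dual-power-cut true false k e z = dual-power-suc A (suc k) z
    dual-power-cut false true k e z = dual-power-suc A (suc k) z
    dual-power-cut false false k e z = dual-power-scalar A (suc k) (trans e (-‿inverseʳ _)) z

  -- The φ_e-coefficient of Σ_{l∈I} X_l is the difference of the indicator of I at the two ends of
  -- e. It vanishes unless e crosses the cut, and then one more power kills the whole element.
  X-power : ∀ {N m} (es : Edges N m) f →
    KAlgebra._≈_ (tower m) (KAlgebra._^_ (tower m) (lin (tower m) (⟨_⟩ ∘ f) (X es)) (suc (cut es f))) (KAlgebra.0# (tower m))
  X-power {N} {zero} es f = K.trans (K.*-identityʳ _)
    (trans (sum-cong-≋ (λ l → zeroʳ ⟨ f l ⟩)) (sum-replicate-zero N))
    where
    open KAlgebra (tower zero)
  X-power {N} {suc m} es f = D.trans (D.^-congˡ (suc (cut es f)) (dual-lin (tower m) (⟨_⟩ ∘ f) (X (es ∘ suc)) _))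
    (dual-power-cut (tower m) (f (proj₁ (es zero))) (f (proj₂ (es zero))) (cut (es ∘ suc) f)
      (lin-incidence (tower m) (⟨_⟩ ∘ f) (proj₁ (es zero)) (proj₂ (es zero)))
      (X-power (es ∘ suc) f))
    where
    module D = KAlgebra (tower (suc m))

  -- Without edges every X_l is zero, and each variable lies in the ideal: it is the generator of a
  -- singleton, whose exponent is 0 + 1. So p agrees modulo the ideal with its constant term, which
  -- is zero by hypothesis.
  edgeless-complete : ∀ {N} (es : Edges N 0) p → Vanishes es p → p ∈I es
  edgeless-complete {N} es p e = ≈∈I
    (trans (+-congˡ (trans (*-congˡ (trans (con-cong e) ι-0)) (zeroʳ _))) (+-identityʳ p)) (constant-term p)
    where
    open KAlgebra (free N)
    ε : Expr N → K.Carrier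
    ε = eval (tower 0) (X es)
    var∈I : ∀ i → var i ∈I es
    var∈I i = ≈∈I (begin
      1# * (lin (free N) (δ i) var * 1#)   ≈⟨ solve 1 (λ x → :1 :* (x :* :1) := x) refl _ ⟩
      lin (free N) (δ i) var               ≈⟨ sum-cong-≋ (λ l → ι-⟨⟩ (free N) (does (l Fin.≟ i)) (var l)) ⟩
      sum (λ l → if does (l Fin.≟ i) then var l else 0#) ≈⟨ sum-single var i ⟩
      var i                                ∎) (generator 1# (λ l → does (l Fin.≟ i)))
      where
      open ≈-Reasoning
    constant-term : ∀ p → (p ⊕ (- con (ε p))) ∈I es
    constant-term (con x) = ≈∈I (sym (-‿inverseʳ (con x))) 0∈I
    constant-term (var l) = ≈∈I (solve 1 (λ x → x := x :- :0) refl (var l)) (var∈I l)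
    constant-term (p ⊕ q) = ≈∈I
      (trans (solve 4 (λ p q x y → (p :- x) :+ (q :- y) := (p :+ q) :- (x :+ y)) refl p q (con (ε p)) (con (ε q)))
        (+-congˡ (-‿cong (sym (con-+ (ε p) (ε q))))))
      (+∈I (constant-term p) (constant-term q))
    constant-term (p ⊗ q) = ≈∈I
      (trans (solve 4 (λ p q x y → q :* (p :- x) :+ x :* (q :- y) := (p :* q) :- (x :* y)) refl p q (con (ε p)) (con (ε q)))
        (+-congˡ (-‿cong (sym (con-* (ε p) (ε q))))))
      (+∈I (*∈I q (constant-term p)) (*∈I (con (ε p)) (constant-term q)))

  xor-same : ∀ b → (if b xor b then 1 else 0) ≡ 0
  xor-same true = ≡.refl
  xor-same false = ≡.refl

  loop∈I : ∀ {N m} (es : Edges N (suc m)) → proj₁ (es zero) ≡ proj₂ (es zero) → ∀ {p} → p ∈I (es ∘ suc) → p ∈I es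
  loop∈I {N} es loop (generator h f) = ≈∈I
    (⊗-cong ≈-refl (KAlgebra.^-congʳ (free N) (lin (free N) (⟨_⟩ ∘ f) var) (≡.cong suc cut-loop))) (generator h f)
    where
    cut-loop : cut es f ≡ cut (es ∘ suc) f
    cut-loop rewrite loop | xor-same (f (proj₂ (es zero))) = ≡.refl
  loop∈I es loop 0∈I = 0∈I
  loop∈I es loop (+∈I p q) = +∈I (loop∈I es loop p) (loop∈I es loop q)
  loop∈I es loop (≈∈I e p) = ≈∈I e (loop∈I es loop p)

  module Contraction {N m} (es : Edges N (suc m)) where
    open KAlgebra (free N)
    open ≈-Reasoning
    i = proj₁ (es zero)
    j = proj₂ (es zero)
    w = incidence (i , j)
    rest = es ∘ suc
    open Derivation w

    d-form : ∀ f → d (lin (free N) (⟨_⟩ ∘ f) var) ≈ con ⟨ f i ⟩ - con ⟨ f j ⟩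
    d-form f = trans (d-lin (⟨_⟩ ∘ f)) (lin-incidence (free N) (⟨_⟩ ∘ f) i j)

    module _ (i≢j : i ≢ j) where
      wi≈1 : w i K.≈ K.1#
      wi≈1 with i Fin.≟ i | i Fin.≟ j
      ... | yes _ | no _ = K.trans (K.+-congˡ (RP.ε⁻¹≈ε)) (K.+-identityʳ K.1#)
        where
        module RP = AbelianGroupProperties K.+-abelianGroup
      ... | yes _ | yes e = contradiction e i≢j
      ... | no ¬e | _ = contradiction ≡.refl ¬e

      wj≈-1 : w j K.≈ K.- K.1#
      wj≈-1 with j Fin.≟ i | j Fin.≟ j
      ... | no _ | yes _ = K.+-identityˡ _
      ... | yes e | _ = contradiction (≡.sym e) i≢j
      ... | no _ | no ¬e = contradiction ≡.refl ¬e

      -- Let u be the linear form of a generator h u^(k + 1) of the deletion. If the edge crosses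
      -- the cut, the exponent in G is k + 2 and `d u` is 1 or -1, so integration by parts against u
      -- supplies the missing power. Otherwise the exponent is unchanged and `d u` is zero, so u^(k
      -- + 1) is a constant for `d` and only h is integrated, with x_i as the coordinate of
      -- derivative 1.
      primitive∈I : ∀ {h} → h ∈I rest → ∃ λ q → q ∈I es × d q ≈ h
      primitive∈I (generator h f) = case-cut (f i) (f j) (cut rest f) (cut es f) ≡.refl (d-form f) (λ g → generator g f)
        where
        u = lin (free N) (⟨_⟩ ∘ f) var
        same-side : ∀ k → d u ≈ 0# → (∀ g → (g ⊗ u ^ suc k) ∈I es) → ∃ λ q → q ∈I es × d q ≈ h ⊗ u ^ suc k
        same-side k du≈0 gen = g ⊗ u ^ suc k , gen g ,
          trans (+-cong (trans (*-congˡ (trans (d-^ du≈0 k) (solve 2 (λ n y → (n :* :0) :* y := :0) refl _ (u ^ k)))) (zeroʳ g))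
            (*-congʳ (proj₂ G))) (+-identityˡ _)
          where
          G = antiderivative {var i} (con-cong wi≈1) h
          g = proj₁ G
        opposite-sides : ∀ k s → d u ≈ con s → con s * con s ≈ 1# → (∀ g → (g ⊗ u ^ suc (suc k)) ∈I es) →
          ∃ λ q → q ∈I es × d q ≈ h ⊗ u ^ suc k
        opposite-sides k s du ss≈1 gen = proj₁ G ⊗ u ^ suc (suc k) , gen (proj₁ G) , proj₂ G
          where G = antiderivative-power {u} {s} {s} du ss≈1 h (suc k)
        case-cut : ∀ b b′ k k′ → k′ ≡ (if b xor b′ then 1 else 0) ℕ.+ k → d u ≈ con ⟨ b ⟩ - con ⟨ b′ ⟩ →
          (∀ g → (g ⊗ u ^ suc k′) ∈I es) → ∃ λ q → q ∈I es × d q ≈ h ⊗ u ^ suc k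
        case-cut true true k _ ≡.refl du = same-side k (trans du (-‿inverseʳ 1#))
        case-cut false false k _ ≡.refl du = same-side k (trans du (-‿inverseʳ 0#))
        case-cut true false k _ ≡.refl du = opposite-sides k K.1# (trans du (solve 0 (:1 :- :0 := :1) refl)) (*-identityˡ 1#)
        case-cut false true k _ ≡.refl du = opposite-sides k (K.- K.1#)
          (trans du (trans (+-identityˡ (- 1#)) (*-identityʳ _)))
          (trans (*-cong (ι-neg K.1#) (ι-neg K.1#)) (solve 0 ((:- :1) :* (:- :1) := :1) refl))
      primitive∈I 0∈I = 0# , 0∈I , refl
      primitive∈I (+∈I p q) = proj₁ P ⊕ proj₁ Q , +∈I (proj₁ (proj₂ P)) (proj₁ (proj₂ Q)) , +-cong (proj₂ (proj₂ P)) (proj₂ (proj₂ Q))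
        where
        P = primitive∈I p
        Q = primitive∈I q
      primitive∈I (≈∈I e p) = proj₁ P , proj₁ (proj₂ P) , trans (proj₂ (proj₂ P)) e
        where P = primitive∈I p

      -- Contracting the edge ij relabels j as i, which leaves j isolated.
      π : Fin N → Fin N
      π l = if does (l Fin.≟ j) then i else l

      contract : ∀ {k} → Edges N k → Edges N k
      contract es e = π (proj₁ (es e)) , π (proj₂ (es e))

      contracted : Edges N m
      contracted = contract rest

      π-δ : ∀ l a → δ (π a) l K.≈ δ a l K.+ w l K.* δ a j
      π-δ l a = by-cases l a (a Fin.≟ j)
        where
        module KS = IntegerSolver K
        by-cases : ∀ l a → Dec (a ≡ j) → δ (π a) l K.≈ δ a l K.+ w l K.* δ a j
        by-cases l a (yes ≡.refl) rewrite dec-true (j Fin.≟ j) ≡.refl =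
          KS.solve 2 (λ x y → x KS.:= y KS.:+ (x KS.:- y) KS.:* KS.:1) K.refl (δ i l) (δ j l)
        by-cases l a (no a≢j) rewrite dec-false (a Fin.≟ j) a≢j | dec-false (j Fin.≟ a) (a≢j ∘ ≡.sym) =
          KS.solve 2 (λ x y → x KS.:= x KS.:+ y KS.:* KS.:0) K.refl (δ a l) (w l)

      π-incidence : ∀ l a b → incidence (π a , π b) l K.≈ incidence (a , b) l K.+ w l K.* incidence (a , b) j
      π-incidence l a b = K.trans (K.+-cong (π-δ l a) (K.-‿cong (π-δ l b)))
        (KS.solve 5 (λ x y w x′ y′ → (x KS.:+ w KS.:* x′) KS.:- (y KS.:+ w KS.:* y′) KS.:= (x KS.:- y) KS.:+ w KS.:* (x′ KS.:- y′))
          K.refl (δ a l) (δ b l) (w l) (δ a j) (δ b j))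
        where
        module KS = IntegerSolver K

      π-⟨⟩ : ∀ (f : Fin N → Bool) l → ⟨ f (π l) ⟩ K.≈ ⟨ f l ⟩ K.+ δ j l K.* (⟨ f i ⟩ K.- ⟨ f j ⟩)
      π-⟨⟩ f l = by-cases (l Fin.≟ j)
        where
        module KS = IntegerSolver K
        by-cases : Dec (l ≡ j) → ⟨ f (π l) ⟩ K.≈ ⟨ f l ⟩ K.+ δ j l K.* (⟨ f i ⟩ K.- ⟨ f j ⟩)
        by-cases (yes ≡.refl) rewrite dec-true (j Fin.≟ j) ≡.refl =
          KS.solve 2 (λ x y → x KS.:= y KS.:+ KS.:1 KS.:* (x KS.:- y)) K.refl ⟨ f i ⟩ ⟨ f j ⟩
        by-cases (no l≢j) rewrite dec-false (l Fin.≟ j) l≢j =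
          KS.solve 2 (λ x y → x KS.:= x KS.:+ KS.:0 KS.:* y) K.refl ⟨ f l ⟩ (⟨ f i ⟩ K.- ⟨ f j ⟩)

      -- `retract` sends x_i to x_i + x_j and x_j to 0, and contraction does the same to the X_l,
      -- because every edge end at j moves to i. Evaluation on the contracted graph is therefore
      -- evaluation on the deletion after `retract`.
      X-contracted : ∀ {k} (es : Edges N k) l → KAlgebra._≈_ (tower k) (X (contract es) l)
        (KAlgebra._+_ (tower k) (X es l) (KAlgebra._*_ (tower k) (KAlgebra.ι (tower k) (w l)) (X es j)))
      X-contracted {zero} es l = K.sym (K.trans (K.+-identityˡ _) (K.zeroʳ _))
      X-contracted {suc k} es l = X-contracted (es ∘ suc) l ,
        T.trans (T.ι-cong (π-incidence l (proj₁ (es zero)) (proj₂ (es zero))))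
          (T.trans (T.ι-+ _ _) (T.+-congˡ (T.trans (T.ι-* _ _) (T.sym (T.trans (T.+-congˡ (T.zeroˡ _)) (T.+-identityʳ _))))))
        where
        module T = KAlgebra (tower k)

      -- Since x_i becomes x_i + x_j and x_j becomes 0, the new vertex set contains j exactly when
      -- it contains i; it is the preimage of I under `π`.
      retract-form : ∀ f → eval (free N) (retract j wj≈-1) (lin (free N) (⟨_⟩ ∘ f) var) ≈ lin (free N) (⟨_⟩ ∘ f ∘ π) var
      retract-form f = begin
        eval (free N) (retract j wj≈-1) (lin (free N) χ var) ≈⟨ eval-lin (free N) (retract j wj≈-1) χ ⟩
        lin (free N) χ (λ l → var l + con (w l) * var j)
          ≈⟨ trans (lin-+ (free N) χ var (λ l → con (w l) * var j)) (+-congˡ (lin-* (free N) χ (con ∘ w) (var j))) ⟩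
        lin (free N) χ var + lin (free N) χ (con ∘ w) * var j
          ≈⟨ +-congˡ (*-congʳ (lin-incidence (free N) χ i j)) ⟩
        lin (free N) χ var + (con ⟨ f i ⟩ - con ⟨ f j ⟩) * var j
          ≈⟨ +-congˡ (trans (*-comm _ _) (*-congˡ (sym (trans (con-+ _ _) (+-congˡ (ι-neg _)))))) ⟩
        lin (free N) χ var + var j * con s
          ≈⟨ +-congˡ (*-congʳ (sum-single var j)) ⟨
        lin (free N) χ var + sum (λ l → if does (l Fin.≟ j) then var l else 0#) * con s
          ≈⟨ +-congˡ (*-congʳ (sum-cong-≋ (λ l → ι-⟨⟩ (free N) (does (l Fin.≟ j)) (var l)))) ⟨
        lin (free N) χ var + sum (λ l → con (δ j l) * var l) * con s
          ≈⟨ +-congˡ (*-distribʳ-sum (con s) (λ l → con (δ j l) * var l)) ⟩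
        lin (free N) χ var + sum (λ l → (con (δ j l) * var l) * con s)
          ≈⟨ ∑-distrib-+ (λ l → con (χ l) * var l) (λ l → (con (δ j l) * var l) * con s) ⟨
        sum (λ l → con (χ l) * var l + (con (δ j l) * var l) * con s)
          ≈⟨ sum-cong-≋ (λ l → trans (solve 4 (λ p q r x → p :* x :+ (q :* x) :* r := (p :+ q :* r) :* x) refl _ _ _ _)
               (*-congʳ (sym (trans (con-cong (π-⟨⟩ f l)) (trans (con-+ _ _) (+-congˡ (con-* _ _))))))) ⟩
        lin (free N) (⟨_⟩ ∘ f ∘ π) var ∎
        where
        χ = ⟨_⟩ ∘ f
        s = ⟨ f i ⟩ K.- ⟨ f j ⟩

      -- The edge ij has both ends on the same side of `f ∘ π`, so a generator of the contraction
      -- retracts to a generator of G with the same exponent.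
      cut-contracted : ∀ f → cut es (f ∘ π) ≡ cut contracted f
      cut-contracted f rewrite dec-true (j Fin.≟ j) ≡.refl | dec-false (i Fin.≟ j) i≢j =
        ≡.trans (≡.cong (ℕ._+ cut rest (f ∘ π)) (xor-same (f i))) (go rest)
        where
        go : ∀ {m} (rest : Edges N m) → cut rest (f ∘ π) ≡ cut (contract rest) f
        go {zero} rest = ≡.refl
        go {suc m} rest = ≡.cong ((if f (π (proj₁ (rest zero))) xor f (π (proj₂ (rest zero))) then 1 else 0) ℕ.+_) (go (rest ∘ suc))

      retract∈I : ∀ {p} → p ∈I contracted → eval (free N) (retract j wj≈-1) p ∈I es
      retract∈I (generator h f) = ≈∈I
        (*-congˡ (sym (trans (eval-^ (free N) (retract j wj≈-1) (lin (free N) (⟨_⟩ ∘ f) var) (suc (cut contracted f)))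
          (^-cong (retract-form f) (≡.cong suc (≡.sym (cut-contracted f)))))))
        (generator (eval (free N) (retract j wj≈-1) h) (f ∘ π))
      retract∈I 0∈I = 0∈I
      retract∈I (+∈I p q) = +∈I (retract∈I p) (retract∈I q)
      retract∈I (≈∈I e p) = ≈∈I (eval-cong (free N) (retract j wj≈-1) e) (retract∈I p)

      -- Correct p by an element q of the ideal with the same derivative along the edge;
      -- the difference then comes from the contracted graph.
      complete-step :
        (∀ p → Vanishes rest p → p ∈I rest) → (∀ p → Vanishes contracted p → p ∈I contracted) →
        ∀ p → Vanishes es p → p ∈I es
      complete-step deletion contraction p e = ≈∈I
        (trans (+-congʳ (sym (kernel-retract j wj≈-1 r dr≈0))) (solve 2 (λ p q → (p :- q) :+ q := p) refl p q))
        (+∈I (retract∈I (contraction r r≈0)) q∈I)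
        where
        module T = KAlgebra (tower m)
        components : ∀ p → Vanishes es p → Vanishes rest p × Vanishes rest (d p)
        components p e = T.trans (T.sym (proj₁ (eval-dual (tower m) (X rest) w p))) (proj₁ e) ,
                         T.trans (T.sym (proj₂ (eval-dual (tower m) (X rest) w p))) (proj₂ e)
        Q = primitive∈I (deletion (d p) (proj₂ (components p e)))
        q = proj₁ Q
        q∈I = proj₁ (proj₂ Q)
        r = p - q
        dr≈0 : d r ≈ 0#
        dr≈0 = trans (+-congˡ (trans (d-con* _ q) (*-congˡ (proj₂ (proj₂ Q))))) (-‿inverseʳ (d p))
        -- Vanishing on the contraction means that the retract of r vanishes on the deletion.
        -- `retract` fixes r because `d r` is zero, and both p and q vanish on the deletion.
        r≈0 : Vanishes contracted r
        r≈0 = T.trans (eval-pointwise (tower m) (X-contracted rest) r)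
          (T.trans (T.sym (eval-substitute (tower m) (X rest) (retract j wj≈-1) r))
          (T.trans (T.sym (eval-cong (tower m) (X rest) (kernel-retract j wj≈-1 r dr≈0)))
          (T.trans (T.+-cong (proj₁ (components p e)) (eval-neg (tower m) (X rest) q))
          (T.trans (T.+-congˡ (T.-‿cong (proj₁ (components q (∈I-vanishes (tower (suc m)) (X es) (X-power es) q∈I)))))
            (T.-‿inverseʳ T.0#)))))

  -- Deletion and contraction both have one edge fewer on the same vertex set, so induction on the
  -- number of edges covers both; a loop is merely deleted.
  complete : ∀ {N m} (es : Edges N m) p → Vanishes es p → p ∈I es
  complete {m = zero} es p e = edgeless-complete es p e
  complete {m = suc m} es p e with proj₁ (es zero) Fin.≟ proj₂ (es zero)
  ... | yes loop = loop∈I es loop (complete (es ∘ suc) p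
    (T.trans (T.sym (proj₁ (eval-dual (tower m) (X (es ∘ suc)) (incidence (es zero)) p))) (proj₁ e)))
    where
    module T = KAlgebra (tower m)
  ... | no i≢j = Contraction.complete-step es i≢j (complete (es ∘ suc)) (complete (Contraction.contracted es i≢j)) p e

-- From the additive to the multiplicative relations.

module MultiplicativeTheorem {c ℓ} (K : CommutativeRing c ℓ) (inv : ℕ → CommutativeRing.Carrier K)
  (inv-correct : ∀ k → CommutativeRing._≈_ K (CommutativeRing._*_ K (natK K (suc k)) (inv k)) (CommutativeRing.1# K))
  where
  private module K = CommutativeRing K
  open FreeAlgebra K
  open AdditiveTheorem K inv inv-correct
  private module Ex {a b} (A : KAlgebra K a b) = Exponential K inv inv-correct A

  module _ {a b} (A : KAlgebra K a b) where
    open KAlgebra A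
    open Ex A
    private
      module D = KAlgebra (dual A)
      module DE = Ex (dual A)

    γ-scalar : ∀ x k → DE.γ (x , 0#) k D.≈ (γ x k , 0#)
    γ-scalar x zero = D.refl
    γ-scalar x (suc k) = D.trans (D.*-congˡ (D.*-congˡ (γ-scalar x k)))
      (refl , solve 3 (λ x i y → x :* (i :* :0 :+ :0 :* y) :+ :0 :* (i :* y) := :0) refl x (ιinv k) (γ x k))

    partialSum-scalar : ∀ t f → D.partialSum t (λ k → f k , 0#) D.≈ (partialSum t f , 0#)
    partialSum-scalar zero f = D.refl
    partialSum-scalar (suc t) f = D.trans (D.+-congˡ (partialSum-scalar t (f ∘ suc))) (refl , +-identityˡ 0#)

    Exp-scalar : ∀ {x y} → Exp x y → DE.Exp (x , 0#) (y , 0#)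
    Exp-scalar {x} (p , z , e) = p , D.trans (^-scalar A x p) (z , refl) ,
      D.trans (D.partialSum-cong p (γ-scalar x)) (D.trans (partialSum-scalar p (γ x)) (e , refl))

    Exp-infinitesimal : ∀ x′ → DE.Exp (0# , x′) (1# , x′)
    Exp-infinitesimal x′ = 2 ,
      (solve 0 (:0 :* (:0 :* :1) := :0) refl ,
       solve 1 (λ x → :0 :* (:0 :* :0 :+ x :* :1) :+ x :* (:0 :* :1) := :0) refl x′) ,
      (solve 1 (λ i → :1 :+ (:0 :* (i :* :1) :+ :0) := :1) refl (ιinv 0) ,
       trans (solve 2 (λ x i → :0 :+ ((:0 :* (i :* :0 :+ :0 :* :1) :+ x :* (i :* :1)) :+ :0) := x :* i) refl x′ (ιinv 0))
         (trans (*-congˡ ιinv-0) (*-identityʳ x′)))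

    -- Splitting x + ε x′ into a scalar and an infinitesimal summand gives exp(x + ε x′) = exp(x) (1
    -- + ε x′). With `x′` the incidence of an edge this is the recursion that defines `Yᵗ`.
    Exp-dual : ∀ {x y} x′ → Exp x y → DE.Exp (x , x′) (y , x′ * y)
    Exp-dual {x} {y} x′ E = DE.Exp-cong (+-identityʳ x , +-identityˡ x′)
      (*-identityʳ y , solve 2 (λ x y → y :* x :+ :0 :* :1 := x :* y) refl x′ y)
      (DE.Exp-+ (Exp-scalar E) (Exp-infinitesimal x′))

    Exp-⟨⟩ : ∀ b {x y} → Exp x y → Exp (ι ⟨ b ⟩ * x) (if b then y else 1#)
    Exp-⟨⟩ true {x} E = Exp-cong (sym (ι-⟨⟩ A true x)) refl E
    Exp-⟨⟩ false {x} E = Exp-cong (sym (ι-⟨⟩ A false x)) refl Exp-0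

    Exp-lin : ∀ {N} {x y : Fin N → Carrier} → (∀ l → Exp (x l) (y l)) → ∀ f →
      Exp (lin A (⟨_⟩ ∘ f) x) (product (λ l → if f l then y l else 1#))
    Exp-lin E f = Exp-sum (λ l → Exp-⟨⟩ (f l) (E l))

    -- To substitute exponentials as polynomials, one truncation bound must serve all variables; the
    -- slack `t` allows the bounds of two algebras to be added.
    Exp-common-truncation : ∀ {N} {x y : Fin N → Carrier} → (∀ l → Exp (x l) (y l)) →
      ∃ λ T → ∀ t l → exp (T ℕ.+ t) (x l) ≈ y l
    Exp-common-truncation {zero} E = 0 , λ t ()
    Exp-common-truncation {suc N} {x} {y} E = p ℕ.+ proj₁ R , bound
      where
      p = proj₁ (E zero)
      R = Exp-common-truncation (E ∘ suc)
      bound : ∀ t l → exp ((p ℕ.+ proj₁ R) ℕ.+ t) (x l) ≈ y l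
      bound t zero = trans (reflexive (≡.cong (λ n → exp n (x zero)) (ℕₚ.+-assoc p (proj₁ R) t))) (Exp-truncation (E zero) _)
      bound t (suc l) = trans (reflexive (≡.cong (λ n → exp n (x (suc l))) shuffle)) (proj₂ R (p ℕ.+ t) l)
        where
        shuffle : (p ℕ.+ proj₁ R) ℕ.+ t ≡ proj₁ R ℕ.+ (p ℕ.+ t)
        shuffle = ≡.trans (≡.cong (ℕ._+ t) (ℕₚ.+-comm p (proj₁ R))) (ℕₚ.+-assoc (proj₁ R) p t)

    eval-exp : ∀ {N} (ρ : Fin N → Carrier) T p → eval A ρ (Ex.exp (free N) T p) ≈ exp T (eval A ρ p)
    eval-exp {N} ρ T p = trans (eval-partialSum T (Ex.γ (free N) p)) (partialSum-cong T eval-γ)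
      where
      eval-partialSum : ∀ t f → eval A ρ (KAlgebra.partialSum (free N) t f) ≈ partialSum t (eval A ρ ∘ f)
      eval-partialSum zero f = ι-0
      eval-partialSum (suc t) f = +-congˡ (eval-partialSum t (f ∘ suc))
      eval-γ : ∀ k → eval A ρ (Ex.γ (free N) p k) ≈ γ (eval A ρ p) k
      eval-γ zero = ι-1
      eval-γ (suc k) = *-congˡ (*-congˡ (eval-γ k))

  Yᵗ : ∀ {N m} → Edges N m → Fin N → KAlgebra.Carrier (tower m)
  Yᵗ {m = zero} es l = K.1#
  Yᵗ {m = suc m} es l = Yᵗ (es ∘ suc) l , KAlgebra._*_ (tower m) (KAlgebra.ι (tower m) (incidence (es zero) l)) (Yᵗ (es ∘ suc) l)

  Exp-X : ∀ {N m} (es : Edges N m) l → Ex.Exp (tower m) (X es l) (Yᵗ es l)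
  Exp-X {m = zero} es l = Ex.Exp-0 (tower zero)
  Exp-X {m = suc m} es l = Exp-dual (tower m) (KAlgebra.ι (tower m) (incidence (es zero) l)) (Exp-X (es ∘ suc) l)

  module _ {N m} (es : Edges N m) where
    open KAlgebra (tower m)

    Yᵗ-power : ∀ f → (product (λ l → if f l then Yᵗ es l else 1#) - 1#) ^ suc (cut es f) ≈ 0#
    Yᵗ-power f = Ex.power-zero-Exp (tower m) (suc (cut es f)) (Exp-lin (tower m) (Exp-X es) f) (X-power es f)

  module _ {a b} (A : KAlgebra K a b) {N m} (es : Edges N m) where
    open KAlgebra A
    open Ex A
    private module T = KAlgebra (tower m)

    -- Substitute truncated exponentials for the variables of p. The result takes the value p(Y) = 0
    -- at X, so it lies in the additive ideal. It then vanishes at logarithms of the y l in any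
    -- algebra with the relations, and there its value is p(y).
    multiplicative-complete : ∀ (y : Fin N → Carrier) →
      (∀ f → (product (λ l → if f l then y l else 1#) - 1#) ^ suc (cut es f) ≈ 0#) →
      ∀ p → eval (tower m) (Yᵗ es) p T.≈ T.0# → eval A y p ≈ 0#
    multiplicative-complete y H p Yp≈0 = begin
      eval A y p                              ≈⟨ eval-pointwise A (λ l → sym (trans (reflexive (≡.cong (λ n → exp n (x l)) (ℕₚ.+-comm t₁ t₂))) (proj₂ B₂ t₁ l))) p ⟩
      eval A (λ l → exp t (x l)) p            ≈⟨ eval-pointwise A (λ l → sym (eval-exp A x t (var l))) p ⟩
      eval A (λ l → eval A x (expvar l)) p    ≈⟨ eval-substitute A x expvar p ⟨
      eval A x (eval (free N) expvar p)       ≈⟨ ∈I-vanishes A x x-power (complete es (eval (free N) expvar p) substituted≈0) ⟩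
      0#                                      ∎
      where
      open ≈-Reasoning
      -- The relation for the singleton of l makes y l - 1 nilpotent, as a logarithm requires.
      logs : ∀ l → ∃ λ x → Exp x (y l)
      logs l = log (suc (cut es (λ i → does (i Fin.≟ l))))
        (trans (^-congˡ (suc (cut es (λ i → does (i Fin.≟ l)))) (+-congʳ (sym (product-single y l)))) (H (λ i → does (i Fin.≟ l))))
      x : Fin N → Carrier
      x l = proj₁ (logs l)
      x-power : ∀ f → lin A (⟨_⟩ ∘ f) x ^ suc (cut es f) ≈ 0#
      x-power f = Exp-power-zero (suc (cut es f)) (Exp-lin A (λ l → proj₂ (logs l)) f) (H f)
      B₁ = Exp-common-truncation (tower m) (Exp-X es)
      B₂ = Exp-common-truncation A (λ l → proj₂ (logs l))
      t₁ = proj₁ B₁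
      t₂ = proj₁ B₂
      t = t₁ ℕ.+ t₂
      expvar : Fin N → Expr N
      expvar l = Ex.exp (free N) t (var l)
      substituted≈0 : eval (tower m) (X es) (eval (free N) expvar p) T.≈ T.0#
      substituted≈0 = T.trans (eval-substitute (tower m) (X es) expvar p)
        (T.trans (eval-pointwise (tower m) (λ l → T.trans (eval-exp (tower m) (X es) t (var l)) (proj₂ B₁ t₂ l)) p) Yp≈0)

-- Polynomials as lists of terms.

=ℕᵇ-refl : ∀ {k} (μ : Vec ℕ k) → (μ =ℕᵇ μ) ≡ true
=ℕᵇ-refl [] = ≡.refl
=ℕᵇ-refl (a ∷ μ) = ≡.cong₂ _∧_ (dec-true (a ℕ.≟ a) ≡.refl) (=ℕᵇ-refl μ)

=ℕᵇ-sound : ∀ {k} (μ ν : Vec ℕ k) → (μ =ℕᵇ ν) ≡ true → μ ≡ ν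
=ℕᵇ-sound [] [] _ = ≡.refl
=ℕᵇ-sound (a ∷ μ) (b ∷ ν) e = ≡.cong₂ _∷_ (ℕₚ.≡ᵇ⇒≡ a b (≡.subst T (≡.sym (proj₁ both)) _)) (=ℕᵇ-sound μ ν (proj₂ both))
  where
  ∧-true : ∀ x y → (x ∧ y) ≡ true → x ≡ true × y ≡ true
  ∧-true true true _ = ≡.refl , ≡.refl
  both = ∧-true (a ℕ.≡ᵇ b) (μ =ℕᵇ ν) e

_+ᵛ_ : ∀ {k} → Vec ℕ k → Vec ℕ k → Vec ℕ k
_+ᵛ_ = Vec.zipWith ℕ._+_

module Polynomials {c ℓ} (K : CommutativeRing c ℓ) {n : ℕ} (G : Graph n) where
  private
    module K = CommutativeRing K
    𝕄 = Vec ℕ (suc n)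
    ℙ = Poly K G

  module Functional {a b} (R : CommutativeRing a b) where
    open CommutativeRing R
    open IntegerSolver R

    -- Coefficients, evaluation and each argument of the product are sums of this form, so the
    -- single lemma `total-≈P` shows that all of them respect equality of polynomials.
    total : (K.Carrier → 𝕄 → Carrier) → ℙ → Carrier
    total F [] = 0#
    total F ((x , μ) ∷ p) = F x μ + total F p

    total-cong : ∀ {F F′} → (∀ x μ → F x μ ≈ F′ x μ) → ∀ p → total F p ≈ total F′ p
    total-cong e [] = refl
    total-cong e ((x , μ) ∷ p) = +-cong (e x μ) (total-cong e p)

    total-++ : ∀ F p q → total F (p ++ q) ≈ total F p + total F q
    total-++ F [] q = sym (+-identityˡ _)
    total-++ F ((x , μ) ∷ p) q = trans (+-congˡ (total-++ F p q)) (sym (+-assoc _ _ _))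

    total-0 : ∀ p → total (λ _ _ → 0#) p ≈ 0#
    total-0 [] = refl
    total-0 (_ ∷ p) = trans (+-identityˡ _) (total-0 p)

    total-+ : ∀ F F′ p → total (λ x μ → F x μ + F′ x μ) p ≈ total F p + total F′ p
    total-+ F F′ [] = sym (+-identityˡ 0#)
    total-+ F F′ ((x , μ) ∷ p) = trans (+-congˡ (total-+ F F′ p))
      (solve 4 (λ a b c d → (a :+ b) :+ (c :+ d) := (a :+ c) :+ (b :+ d)) refl (F x μ) (F′ x μ) (total F p) (total F′ p))

    total-* : ∀ y F p → total (λ x μ → y * F x μ) p ≈ y * total F p
    total-* y F [] = sym (zeroʳ y)
    total-* y F ((x , μ) ∷ p) = trans (+-congˡ (total-* y F p)) (sym (distribˡ y _ _))

    total-swap : ∀ (H : K.Carrier → 𝕄 → K.Carrier → 𝕄 → Carrier) p q →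
      total (λ x μ → total (H x μ) q) p ≈ total (λ y ν → total (λ x μ → H x μ y ν) p) q
    total-swap H [] q = sym (total-0 q)
    total-swap H ((x , μ) ∷ p) q = trans (+-congˡ (total-swap H p q))
      (sym (total-+ (H x μ) (λ y ν → total (λ x μ → H x μ y ν) p) q))

    total-concatMap : ∀ F h p → total F (List.concatMap h p) ≈ total (λ x μ → total F (h (x , μ))) p
    total-concatMap F h [] = refl
    total-concatMap F h ((x , μ) ∷ p) = trans (total-++ F (h (x , μ)) (List.concatMap h p)) (+-congˡ (total-concatMap F h p))

    total-map : ∀ F h p → total F (List.map h p) ≈ total (λ x μ → F (proj₁ (h (x , μ))) (proj₂ (h (x , μ)))) p
    total-map F h [] = refl
    total-map F h (_ ∷ p) = +-congˡ (total-map F h p)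

    total-mulP : ∀ F p q → total F (mulP K G p q) ≈ total (λ x μ → total (λ y ν → F (x K.* y) (μ +ᵛ ν)) q) p
    total-mulP F p q = trans (total-concatMap F _ p) (total-cong (λ x μ → total-map F _ q) p)

    record Additive (F : K.Carrier → 𝕄 → Carrier) : Set (c ⊔ ℓ ⊔ b) where
      field
        cong : ∀ {x y} μ → x K.≈ y → F x μ ≈ F y μ
        add  : ∀ x y μ → F (x K.+ y) μ ≈ F x μ + F y μ

      zeroᶠ : ∀ μ → F K.0# μ ≈ 0#
      zeroᶠ μ = trans (solve 1 (λ x → x := (x :+ x) :- x) refl (F K.0# μ))
        (trans (+-congʳ (trans (sym (add _ _ μ)) (cong μ (K.+-identityˡ K.0#)))) (-‿inverseʳ _))

      minus : ∀ x μ → F (K.- K.1# K.* x) μ ≈ - F x μ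
      minus x μ = trans (solve 2 (λ x y → y := (y :+ x) :- x) refl (F x μ) (F (K.- K.1# K.* x) μ))
        (trans (+-congʳ (trans (sym (add _ _ μ)) (trans (cong μ cancel) (zeroᶠ μ)))) (+-identityˡ _))
        where
        module KS = IntegerSolver K
        cancel : K.- K.1# K.* x K.+ x K.≈ K.0#
        cancel = KS.solve 1 (λ x → (KS.:- KS.:1) KS.:* x KS.:+ x KS.:= KS.:0) K.refl x

      total-negP : ∀ p → total F (negP K G p) ≈ - total F p
      total-negP [] = solve 0 (:0 := :- :0) refl
      total-negP ((x , μ) ∷ p) = trans (+-cong (minus x μ) (total-negP p))
        (solve 2 (λ x y → :- x :+ :- y := :- (x :+ y)) refl (F x μ) (total F p))

  open module FK = Functional K using () renaming (total to totalᴷ; Additive to Additiveᴷ)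

  pick : 𝕄 → K.Carrier → 𝕄 → K.Carrier
  pick μ x ν = if ν =ℕᵇ μ then x else K.0#

  pick-additive : ∀ μ → Additiveᴷ (pick μ)
  pick-additive μ = record { cong = λ ν → pick-cong (ν =ℕᵇ μ) ; add = λ x y ν → pick-add (ν =ℕᵇ μ) }
    where
    pick-cong : ∀ b {x y} → x K.≈ y → (if b then x else K.0#) K.≈ (if b then y else K.0#)
    pick-cong true e = e
    pick-cong false e = K.refl
    pick-add : ∀ b {x y} → (if b then x K.+ y else K.0#) K.≈ (if b then x else K.0#) K.+ (if b then y else K.0#)
    pick-add true = K.refl
    pick-add false = K.sym (K.+-identityˡ K.0#)

  coeff-total : ∀ p μ → coeff K G p μ ≡ totalᴷ (pick μ) p
  coeff-total [] μ = ≡.refl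
  coeff-total ((x , ν) ∷ p) μ = ≡.cong ((if ν =ℕᵇ μ then x else K.0#) K.+_) (coeff-total p μ)

  remove : 𝕄 → ℙ → ℙ
  remove ν [] = []
  remove ν ((x , μ) ∷ p) = if μ =ℕᵇ ν then remove ν p else (x , μ) ∷ remove ν p

  remove-length : ∀ ν p → List.length (remove ν p) ℕ.≤ List.length p
  remove-length ν [] = ℕ.z≤n
  remove-length ν ((x , μ) ∷ p) with μ =ℕᵇ ν
  ... | true = ℕₚ.m≤n⇒m≤1+n (remove-length ν p)
  ... | false = ℕ.s≤s (remove-length ν p)

  remove-head : ∀ ν x p → remove ν ((x , ν) ∷ p) ≡ remove ν p
  remove-head ν x p rewrite =ℕᵇ-refl ν = ≡.refl

  module _ {a b} (R : CommutativeRing a b) where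
    open CommutativeRing R
    open IntegerSolver R
    open Functional R

    module _ {F} (A : Additive F) where
      open Additive A

      total-remove : ∀ ν p → total F p ≈ F (totalᴷ (pick ν) p) ν + total F (remove ν p)
      total-remove ν [] = sym (trans (+-identityʳ _) (zeroᶠ ν))
      total-remove ν ((x , μ) ∷ p) with μ =ℕᵇ ν in e
      ... | true rewrite =ℕᵇ-sound μ ν e = trans (+-congˡ (total-remove ν p)) (trans (sym (+-assoc _ _ _)) (+-congʳ (sym (add _ _ ν))))
      ... | false = trans (+-congˡ (total-remove ν p))
        (trans (solve 3 (λ x y z → x :+ (y :+ z) := y :+ (x :+ z)) refl (F x μ) (F (totalᴷ (pick ν) p) ν) (total F (remove ν p)))
          (+-congʳ (cong ν (K.sym (K.+-identityˡ _)))))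

  remove-zero : ∀ ν p → (∀ μ → totalᴷ (pick μ) p K.≈ K.0#) → ∀ μ → totalᴷ (pick μ) (remove ν p) K.≈ K.0#
  remove-zero ν p z μ = K.trans (K.sym (K.trans (K.+-congʳ picked) (K.+-identityˡ _)))
    (K.trans (K.sym (total-remove K (pick-additive μ) ν p)) (z μ))
    where
    module A = FK.Additive (pick-additive μ)
    picked : pick μ (totalᴷ (pick ν) p) ν K.≈ K.0#
    picked = K.trans (A.cong ν (z ν)) (A.zeroᶠ ν)

  module _ {a b} (R : CommutativeRing a b) where
    open CommutativeRing R
    open Functional R
    open RingProperties R using (x-y≈0⇒x≈y)

    module _ {F} (A : Additive F) where
      open Additive A

      -- Terms are grouped by exponent vector: those with the exponent of the head add up to its
      -- coefficient, which is zero, and removing them leaves a shorter list whose coefficients are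
      -- still zero. Only exponents are compared, never elements of K. The bound `k` on the length
      -- drives the recursion.
      total-zero : ∀ p → (∀ μ → totalᴷ (pick μ) p K.≈ K.0#) → total F p ≈ 0#
      total-zero p = go (List.length p) p ℕₚ.≤-refl
        where
        go : ∀ k p → List.length p ℕ.≤ k → (∀ μ → totalᴷ (pick μ) p K.≈ K.0#) → total F p ≈ 0#
        go k [] _ _ = refl
        go (suc k) ((x , ν) ∷ p) (ℕ.s≤s le) z = trans (total-remove R A ν ((x , ν) ∷ p))
          (trans (+-cong (trans (cong ν (z ν)) (zeroᶠ ν))
            (trans (reflexive (≡.cong (total F) (remove-head ν x p)))
              (go k (remove ν p) (ℕₚ.≤-trans (remove-length ν p) le)
                (λ μ → K.trans (K.reflexive (≡.cong (totalᴷ (pick μ)) (≡.sym (remove-head ν x p))))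
                  (remove-zero ν ((x , ν) ∷ p) z μ)))))
            (+-identityˡ 0#))

      total-≈P : ∀ p q → _≈P_ K G p q → total F p ≈ total F q
      total-≈P p q e = x-y≈0⇒x≈y (trans (+-congˡ (sym (total-negP q)))
        (trans (sym (total-++ F p (negP K G q))) (total-zero (p ++ negP K G q) (λ μ →
          K.trans (FK.total-++ (pick μ) p (negP K G q))
            (K.trans (K.+-cong (K.trans (K.reflexive (≡.sym (coeff-total p μ))) (K.trans (e μ) (K.reflexive (coeff-total q μ))))
              (FK.Additive.total-negP (pick-additive μ) q)) (K.-‿inverseʳ _))))))

  -- A record rather than a synonym, so that both sides can be inferred from the relation.
  record _≈ₚ_ (p q : ℙ) : Set ℓ where
    constructor by-coefficients
    field coefficients : _≈P_ K G p q
  open _≈ₚ_ public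

  total⇒≈ₚ : ∀ {p q} → (∀ μ → totalᴷ (pick μ) p K.≈ totalᴷ (pick μ) q) → p ≈ₚ q
  total⇒≈ₚ {p} {q} e = by-coefficients λ μ → K.trans (K.reflexive (coeff-total p μ)) (K.trans (e μ) (K.reflexive (≡.sym (coeff-total q μ))))

  mulP-cong : ∀ {p p′ q q′} → p ≈ₚ p′ → q ≈ₚ q′ → mulP K G p q ≈ₚ mulP K G p′ q′
  mulP-cong {p} {p′} {q} {q′} e e′ = total⇒≈ₚ λ μ →
    K.trans (FK.total-mulP (pick μ) p q)
    (K.trans (FK.total-cong (λ x ν → total-≈P K (right-additive μ x ν) q q′ (coefficients e′)) p)
    (K.trans (total-≈P K (left-additive μ) p p′ (coefficients e))
    (K.sym (FK.total-mulP (pick μ) p′ q′))))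
    where
    right-additive : ∀ μ x ν → Additiveᴷ (λ y κ → pick μ (x K.* y) (ν +ᵛ κ))
    right-additive μ x ν = record
      { cong = λ κ e → A.cong (ν +ᵛ κ) (K.*-congˡ e)
      ; add = λ y z κ → K.trans (A.cong (ν +ᵛ κ) (K.distribˡ x y z)) (A.add _ _ (ν +ᵛ κ)) }
      where
      module A = FK.Additive (pick-additive μ)
    left-additive : ∀ μ → Additiveᴷ (λ x ν → totalᴷ (λ y κ → pick μ (x K.* y) (ν +ᵛ κ)) q′)
    left-additive μ = record
      { cong = λ ν e → FK.total-cong (λ y κ → A.cong (ν +ᵛ κ) (K.*-congʳ e)) q′
      ; add = λ x z ν → K.trans
          (FK.total-cong (λ y κ → K.trans (A.cong (ν +ᵛ κ) (K.distribʳ y x z)) (A.add _ _ (ν +ᵛ κ))) q′)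
          (FK.total-+ _ _ q′) }
      where
      module A = FK.Additive (pick-additive μ)

  polynomialRing : CommutativeRing c ℓ
  polynomialRing = makeCommutativeRing _≈ₚ_ (addP K G) (mulP K G) (negP K G) [] (constP K G K.1#)
    (record { refl = by-coefficients λ μ → K.refl
            ; sym = λ e → by-coefficients λ μ → K.sym (coefficients e μ)
            ; trans = λ e e′ → by-coefficients λ μ → K.trans (coefficients e μ) (coefficients e′ μ) })
    (λ {p} {p′} {q} {q′} e e′ → total⇒≈ₚ λ μ → K.trans (FK.total-++ (pick μ) p q)
      (K.trans (K.+-cong (total-≈P K (pick-additive μ) p p′ (coefficients e)) (total-≈P K (pick-additive μ) q q′ (coefficients e′)))
        (K.sym (FK.total-++ (pick μ) p′ q′))))
    (λ p q r → by-coefficients λ μ → K.reflexive (≡.cong (λ s → coeff K G s μ) (Listₚ.++-assoc p q r)))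
    (λ p q → total⇒≈ₚ λ μ → K.trans (FK.total-++ (pick μ) p q) (K.trans (K.+-comm _ _) (K.sym (FK.total-++ (pick μ) q p))))
    (λ p → by-coefficients λ μ → K.refl)
    (λ {p} {p′} e → total⇒≈ₚ λ μ → K.trans (FK.Additive.total-negP (pick-additive μ) p)
      (K.trans (K.-‿cong (total-≈P K (pick-additive μ) p p′ (coefficients e))) (K.sym (FK.Additive.total-negP (pick-additive μ) p′))))
    (λ p → total⇒≈ₚ λ μ → K.trans (FK.total-++ (pick μ) (negP K G p) p)
      (K.trans (K.+-congʳ (FK.Additive.total-negP (pick-additive μ) p)) (K.-‿inverseˡ _)))
    mulP-cong
    (λ p q r → total⇒≈ₚ λ μ →
      K.trans (FK.total-mulP (pick μ) (mulP K G p q) r)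
      (K.trans (FK.total-mulP (λ x ν → totalᴷ (λ y κ → pick μ (x K.* y) (ν +ᵛ κ)) r) p q)
      (K.trans (FK.total-cong (λ x ν → K.trans
          (FK.total-cong (λ y κ → FK.total-cong (λ z λ′ →
            K.trans (FK.Additive.cong (pick-additive μ) ((ν +ᵛ κ) +ᵛ λ′) (K.*-assoc x y z))
              (K.reflexive (≡.cong (pick μ (x K.* (y K.* z))) (Vecₚ.zipWith-assoc ℕₚ.+-assoc ν κ λ′)))) r) q)
          (K.sym (FK.total-mulP (λ y κ → pick μ (x K.* y) (ν +ᵛ κ)) q r))) p)
      (K.sym (FK.total-mulP (pick μ) p (mulP K G q r))))))
    (λ p q → total⇒≈ₚ λ μ →
      K.trans (FK.total-mulP (pick μ) p q)
      (K.trans (FK.total-swap (λ x ν y κ → pick μ (x K.* y) (ν +ᵛ κ)) p q)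
      (K.trans (FK.total-cong (λ y κ → FK.total-cong (λ x ν →
          K.trans (FK.Additive.cong (pick-additive μ) (ν +ᵛ κ) (K.*-comm x y))
            (K.reflexive (≡.cong (pick μ (y K.* x)) (Vecₚ.zipWith-comm ℕₚ.+-comm ν κ)))) p) q)
      (K.sym (FK.total-mulP (pick μ) q p)))))
    (λ p → total⇒≈ₚ λ μ →
      K.trans (FK.total-mulP (pick μ) (constP K G K.1#) p)
      (K.trans (K.+-identityʳ _)
      (FK.total-cong (λ y κ → K.trans (FK.Additive.cong (pick-additive μ) (Vec.replicate (suc n) 0 +ᵛ κ) (K.*-identityˡ y))
        (K.reflexive (≡.cong (pick μ y) (Vecₚ.zipWith-identityˡ {f = ℕ._+_} ℕₚ.+-identityˡ κ)))) p)))
    (λ p q r → total⇒≈ₚ λ μ →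
      K.trans (FK.total-mulP (pick μ) p (q ++ r))
      (K.trans (FK.total-cong (λ x ν → FK.total-++ _ q r) p)
      (K.trans (FK.total-+ _ _ p)
      (K.trans (K.+-cong (K.sym (FK.total-mulP (pick μ) p q)) (K.sym (FK.total-mulP (pick μ) p r)))
      (K.sym (FK.total-++ (pick μ) (mulP K G p q) (mulP K G p r)))))))

-- Quotient rings and evaluation of polynomials.

module Quotient {a b} (R : CommutativeRing a b) where
  open CommutativeRing R
  open IntegerSolver R
  open RingProperties R using (x≈y⇒x-y≈0)

  module Modulo {i} (I : Carrier → Set i) (I-cong : ∀ {x y} → x ≈ y → I x → I y) (I-0 : I 0#)
    (I-+ : ∀ {x y} → I x → I y → I (x + y)) (I-* : ∀ h {x} → I x → I (h * x))
    (_~_ : Rel Carrier i) (I⇒~ : ∀ {x y} → I (x - y) → x ~ y) (~⇒I : ∀ {x y} → x ~ y → I (x - y)) where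

    ≈⇒~ : ∀ {x y} → x ≈ y → x ~ y
    ≈⇒~ e = I⇒~ (I-cong (sym (x≈y⇒x-y≈0 e)) I-0)

    quotientRing : CommutativeRing a i
    quotientRing = makeCommutativeRing _~_ _+_ _*_ -_ 0# 1#
      (record { refl = ≈⇒~ refl
              ; sym = λ {x} {y} p → I⇒~ (I-cong (solve 2 (λ x y → (:- :1) :* (x :- y) := y :- x) refl x y) (I-* (- 1#) (~⇒I p)))
              ; trans = λ {x} {y} {z} p q → I⇒~ (I-cong (solve 3 (λ x y z → (x :- y) :+ (y :- z) := x :- z) refl x y z) (I-+ (~⇒I p) (~⇒I q))) })
      (λ {x} {y} {u} {v} p q →
        I⇒~ (I-cong (solve 4 (λ x y u v → (x :- y) :+ (u :- v) := (x :+ u) :- (y :+ v)) refl x y u v) (I-+ (~⇒I p) (~⇒I q))))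
      (λ x y z → ≈⇒~ (+-assoc x y z))
      (λ x y → ≈⇒~ (+-comm x y))
      (λ x → ≈⇒~ (+-identityˡ x))
      (λ {x} {y} p → I⇒~ (I-cong (solve 2 (λ x y → (:- :1) :* (x :- y) := (:- x) :- (:- y)) refl x y) (I-* (- 1#) (~⇒I p))))
      (λ x → ≈⇒~ (-‿inverseˡ x))
      (λ {x} {y} {u} {v} p q →
        I⇒~ (I-cong (solve 4 (λ x y u v → u :* (x :- y) :+ y :* (u :- v) := (x :* u) :- (y :* v)) refl x y u v)
          (I-+ (I-* u (~⇒I p)) (I-* y (~⇒I q)))))
      (λ x y z → ≈⇒~ (*-assoc x y z))
      (λ x y → ≈⇒~ (*-comm x y))
      (λ x → ≈⇒~ (*-identityˡ x))
      (λ x y z → ≈⇒~ (distribˡ x y z))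

unit : ∀ {k} → Fin k → Vec ℕ k
unit {suc k} zero = 1 ∷ Vec.replicate k 0
unit (suc l) = 0 ∷ unit l

module _ {a b} (R : CommutativeRing a b) where
  open CommutativeRing R hiding (zero)
  open RingProperties R

  monomial-product : ∀ {k} (μ : Vec ℕ k) (mon : Vec ℕ k → Carrier) → mon (Vec.replicate k 0) ≈ 1# →
    (∀ μ ν → mon (μ +ᵛ ν) ≈ mon μ * mon ν) → mon μ ≈ product (λ l → mon (unit l) ^ Vec.lookup μ l)
  monomial-product [] mon one mult = one
  monomial-product {suc k} (e ∷ μ) mon one mult =
    trans (reflexive (≡.cong mon (≡.cong₂ _∷_ (≡.sym (ℕₚ.+-identityʳ e)) (≡.sym (0+ μ)))))
    (trans (mult (e ∷ Vec.replicate k 0) (0 ∷ μ))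
      (*-cong (power e) (monomial-product μ (λ ν → mon (0 ∷ ν)) one (λ ν κ → mult (0 ∷ ν) (0 ∷ κ)))))
    where
    0+ : ∀ {k} (μ : Vec ℕ k) → Vec.replicate k 0 +ᵛ μ ≡ μ
    0+ = Vecₚ.zipWith-identityˡ {f = ℕ._+_} ℕₚ.+-identityˡ
    power : ∀ e → mon (e ∷ Vec.replicate k 0) ≈ mon (1 ∷ Vec.replicate k 0) ^ e
    power zero = one
    power (suc e) = trans (reflexive (≡.cong (λ ν → mon (suc e ∷ ν)) (≡.sym (0+ (Vec.replicate k 0)))))
      (trans (mult (1 ∷ Vec.replicate k 0) (e ∷ Vec.replicate k 0)) (*-congˡ (power e)))

module Evaluation {c ℓ} (K : CommutativeRing c ℓ) {n : ℕ} (G : Graph n) {a b} (A : KAlgebra K a b)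
  (y : Fin (suc n) → KAlgebra.Carrier A) where
  private module K = CommutativeRing K
  open Polynomials K G
  open KAlgebra A
  open Functional commutativeRing

  opaque
    monomial : Mono K G → Carrier
    monomial μ = product (λ l → y l ^ Vec.lookup μ l)

    monomial-+ : ∀ μ ν → monomial (μ +ᵛ ν) ≈ monomial μ * monomial ν
    monomial-+ μ ν = trans
      (product-cong (λ l → trans (^-congʳ (y l) (Vecₚ.lookup-zipWith ℕ._+_ l μ ν)) (^-homo-* (y l) (Vec.lookup μ l) (Vec.lookup ν l))))
      (∏-distrib-* (λ l → y l ^ Vec.lookup μ l) (λ l → y l ^ Vec.lookup ν l))

    monomial-0 : monomial (Vec.replicate (suc n) 0) ≈ 1#
    monomial-0 = trans (product-cong (λ l → ^-congʳ (y l) (Vecₚ.lookup-replicate l 0))) (product-replicate-one (suc n))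

    monomial-unique : (mon : Mono K G → Carrier) → mon (Vec.replicate (suc n) 0) ≈ 1# →
      (∀ μ ν → mon (μ +ᵛ ν) ≈ mon μ * mon ν) → (∀ l → mon (unit l) ≈ y l) → ∀ μ → mon μ ≈ monomial μ
    monomial-unique mon one mult e μ = trans (monomial-product commutativeRing μ mon one mult)
      (product-cong (λ l → ^-congˡ (Vec.lookup μ l) (e l)))

    term : K.Carrier → Mono K G → Carrier
    term x μ = ι x * monomial μ

    evaluate : Poly K G → Carrier
    evaluate = total term

    term-additive : Additive term
    term-additive = record
      { cong = λ μ e → *-congʳ (ι-cong e)
      ; add = λ x y μ → trans (*-congʳ (ι-+ x y)) (distribʳ _ _ _) }

    evaluate-≈P : ∀ p q → _≈P_ K G p q → evaluate p ≈ evaluate q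
    evaluate-≈P = total-≈P commutativeRing term-additive

    evaluate-+ : ∀ p q → evaluate (p ++ q) ≈ evaluate p + evaluate q
    evaluate-+ = total-++ term

    evaluate-neg : ∀ p → evaluate (negP K G p) ≈ - evaluate p
    evaluate-neg = Additive.total-negP term-additive

    evaluate-* : ∀ p q → evaluate (mulP K G p q) ≈ evaluate p * evaluate q
    evaluate-* p q = trans (total-mulP term p q)
      (trans (total-cong (λ x μ → trans (total-cong (λ x′ ν → factor x x′ μ ν) q)
        (trans (total-* (term x μ) term q) (*-comm _ _))) p)
      (trans (total-* (evaluate q) term p) (*-comm _ _)))
      where
      factor : ∀ x x′ μ ν → term (x K.* x′) (μ +ᵛ ν) ≈ term x μ * term x′ ν
      factor x x′ μ ν = trans (*-cong (ι-* x x′) (monomial-+ μ ν))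
        (solve 4 (λ x y m n → (x :* y) :* (m :* n) := (x :* m) :* (y :* n)) refl (ι x) (ι x′) (monomial μ) (monomial ν))

    evaluate-1 : evaluate (constP K G K.1#) ≈ 1#
    evaluate-1 = trans (+-identityʳ _) (trans (*-cong ι-1 monomial-0) (*-identityˡ 1#))

    evaluate-scale : ∀ x p → evaluate (scaleP K G x p) ≈ ι x * evaluate p
    evaluate-scale x p = trans (total-map term _ p)
      (trans (total-cong (λ x′ μ → trans (*-congʳ (ι-* x x′)) (*-assoc _ _ _)) p) (total-* (ι x) term p))

    evaluate-pow : ∀ p k → evaluate (powP K G p k) ≈ evaluate p ^ k
    evaluate-pow p zero = evaluate-1
    evaluate-pow p (suc k) = trans (evaluate-* p (powP K G p k)) (*-congˡ (evaluate-pow p k))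

    evaluate-prodVars : ∀ S → evaluate (prodVars K G S) ≈ product (λ l → if Vec.lookup S l then y l else 1#)
    evaluate-prodVars S = trans (+-identityʳ _) (trans (*-congʳ ι-1) (trans (*-identityˡ _)
      (product-cong (λ l → trans (^-congʳ (y l) (Vecₚ.lookup-map l (λ b → if b then 1 else 0) S)) (exponent (Vec.lookup S l) (y l))))))
      where
      exponent : ∀ b x → x ^ (if b then 1 else 0) ≈ (if b then x else 1#)
      exponent true x = *-identityʳ x
      exponent false x = refl

    evaluate-unique : (φ : Poly K G → Carrier) → φ [] ≈ 0# →
      (∀ x μ p → φ ((x , μ) ∷ p) ≈ φ ((x , μ) ∷ []) + φ p) →
      (∀ x μ → φ ((x , μ) ∷ []) ≈ ι x * φ ((K.1# , μ) ∷ [])) →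
      φ (constP K G K.1#) ≈ 1# →
      (∀ μ ν → φ ((K.1# , μ +ᵛ ν) ∷ []) ≈ φ ((K.1# , μ) ∷ []) * φ ((K.1# , ν) ∷ [])) →
      (∀ l → φ ((K.1# , unit l) ∷ []) ≈ y l) → ∀ p → φ p ≈ evaluate p
    evaluate-unique φ nil cons scale one mult gens [] = nil
    evaluate-unique φ nil cons scale one mult gens ((x , μ) ∷ p) = trans (cons x μ p)
      (+-cong (trans (scale x μ) (*-congˡ (monomial-unique (λ ν → φ ((K.1# , ν) ∷ [])) one mult gens μ)))
        (evaluate-unique φ nil cons scale one mult gens p))

    -- Restates the defining equation for use outside the opaque block, where `evaluate` does not
    -- unfold.
    evaluate-term : ∀ x μ p → evaluate ((x , μ) ∷ p) ≈ ι x * product (λ l → y l ^ Vec.lookup μ l) + evaluate p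
    evaluate-term x μ p = refl

    evaluate-[] : evaluate [] ≈ 0#
    evaluate-[] = refl

  evaluate-gen : ∀ S → evaluate (gen K G S) ≈ (product (λ l → if Vec.lookup S l then y l else 1#) - 1#) ^ suc (D G S)
  evaluate-gen S = trans (evaluate-pow (prodVars K G S ++ negP K G (constP K G K.1#)) (suc (D G S))) (^-congˡ (suc (D G S))
    (trans (evaluate-+ (prodVars K G S) (negP K G (constP K G K.1#)))
      (+-cong (evaluate-prodVars S) (trans (evaluate-neg (constP K G K.1#)) (-‿cong evaluate-1)))))

  evaluate-InIdeal : (∀ S → (product (λ l → if Vec.lookup S l then y l else 1#) - 1#) ^ suc (D G S) ≈ 0#) →
    ∀ p → InIdeal K G p → evaluate p ≈ 0#
  evaluate-InIdeal H p (L , e) = trans (evaluate-≈P p (List.concatMap _ L) e)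
    (combination _ (λ { (h , S , _) → trans (evaluate-* h (gen K G S)) (trans (*-congˡ (trans (evaluate-gen S) (H S))) (zeroʳ _)) }) L)
    where
    combination : ∀ (g : Poly K G × Σ (Subset (suc n)) Nonempty → Poly K G) → (∀ t → evaluate (g t) ≈ 0#) →
      ∀ L → evaluate (List.concatMap g L) ≈ 0#
    combination g z [] = evaluate-[]
    combination g z (t ∷ L) = trans (evaluate-+ (g t) (List.concatMap g L)) (trans (+-cong (z t) (combination g z L)) (+-identityˡ 0#))

  -- The additive theorem quantifies over all vertex sets, the ideal only over nonempty ones. For
  -- the empty set the product is 1, and 1 - 1 is raised to a positive power.
  relation : (∀ S → Nonempty S → evaluate (gen K G S) ≈ 0#) →
    ∀ f → (product (λ l → if f l then y l else 1#) - 1#) ^ suc (D G (Vec.tabulate f)) ≈ 0#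
  relation H f = by-cases (nonempty? S)
    where
    S = Vec.tabulate f
    k = suc (D G S)
    same-factors : ∀ l → (if f l then y l else 1#) ≈ (if Vec.lookup S l then y l else 1#)
    same-factors l = reflexive (≡.cong (λ b → if b then y l else 1#) (≡.sym (Vecₚ.lookup∘tabulate f l)))
    by-cases : Dec (Nonempty S) → (product (λ l → if f l then y l else 1#) - 1#) ^ k ≈ 0#
    by-cases (yes ne) = trans (^-congˡ k (+-congʳ (product-cong same-factors))) (trans (sym (evaluate-gen S)) (H S ne))
    by-cases (no empty) = trans (^-congˡ k (x≈y⇒x-y≈0 (trans (product-cong all-one) (product-replicate-one (suc n)))))
      (zeroˡ (0# ^ D G S))
      where
      all-one : ∀ l → (if f l then y l else 1#) ≈ 1#
      all-one l with f l in e
      ... | true = contradiction (l , Vecₚ.lookup⇒[]= l S (≡.trans (Vecₚ.lookup∘tabulate f l) e)) empty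
      ... | false = refl

-- The algebra 𝓓_G.

module QuotientAlgebra {c ℓ} (K : CommutativeRing c ℓ) {n : ℕ} (G : Graph n) where
  private module K = CommutativeRing K
  open Polynomials K G
  private
    module P = CommutativeRing polynomialRing
    Term = Poly K G × Σ (Subset (suc n)) Nonempty

  InIdeal-cong : ∀ {p q} → p ≈ₚ q → InIdeal K G p → InIdeal K G q
  InIdeal-cong e (L , e′) = L , λ μ → K.trans (K.sym (coefficients e μ)) (e′ μ)

  InIdeal-0 : InIdeal K G []
  InIdeal-0 = [] , λ μ → K.refl

  InIdeal-+ : ∀ {p q} → InIdeal K G p → InIdeal K G q → InIdeal K G (p ++ q)
  InIdeal-+ {p} {q} (L , e) (L′ , e′) = L ++ L′ , coefficients (P.trans
    (P.+-cong {p} {List.concatMap _ L} {q} {List.concatMap _ L′} (by-coefficients e) (by-coefficients e′))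
    (P.reflexive (≡.sym (Listₚ.concatMap-++ _ L L′))))

  InIdeal-* : ∀ h {p} → InIdeal K G p → InIdeal K G (mulP K G h p)
  InIdeal-* h {p} (L , e) = List.map step L , coefficients (P.trans
    (P.*-congˡ {h} {p} {List.concatMap _ L} (by-coefficients e))
    (combination _ (λ { (g , S , _) → P.sym (P.*-assoc h g (gen K G S)) }) L))
    where
    step : Term → Term
    step t = mulP K G h (proj₁ t) , proj₂ t
    combination : ∀ (g : Term → Poly K G) → (∀ t → mulP K G h (g t) ≈ₚ g (step t)) →
      ∀ L → mulP K G h (List.concatMap g L) ≈ₚ List.concatMap g (List.map step L)
    combination g s [] = P.zeroʳ h
    combination g s (t ∷ L) = P.trans (P.distribˡ h (g t) (List.concatMap g L)) (P.+-cong (s t) (combination g s L))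

  record _≈ᴰ_ (p q : Poly K G) : Set (c ⊔ ℓ) where
    constructor modulo-ideal
    field difference : _~D_ K G p q
  open _≈ᴰ_ public

  open Quotient.Modulo polynomialRing (InIdeal K G) (λ {p} {q} → InIdeal-cong {p} {q}) InIdeal-0 (λ {p} {q} → InIdeal-+ {p} {q}) (λ h {p} → InIdeal-* h {p}) _≈ᴰ_ modulo-ideal difference
    renaming (≈⇒~ to ≈ₚ⇒≈ᴰ)

  constant-cong : ∀ {x y} {μ ν : Mono K G} → x K.≈ y → μ ≡ ν → ((x , μ) ∷ []) ≈ₚ ((y , ν) ∷ [])
  constant-cong {x} {y} {μ} e ≡.refl = total⇒≈ₚ λ κ → K.+-congʳ (Functional.Additive.cong (pick-additive κ) μ e)

  0+ᵛ : (μ : Mono K G) → Vec.replicate (suc n) 0 +ᵛ μ ≡ μ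
  0+ᵛ = Vecₚ.zipWith-identityˡ {f = ℕ._+_} ℕₚ.+-identityˡ

  constP-+ : ∀ x y → constP K G (x K.+ y) ≈ₚ (constP K G x ++ constP K G y)
  constP-+ x y = total⇒≈ₚ λ κ → K.trans (K.+-congʳ (Functional.Additive.add (pick-additive κ) x y (Vec.replicate (suc n) 0))) (K.+-assoc _ _ _)

  𝓓 : KAlgebra K c (c ⊔ ℓ)
  𝓓 = record
    { commutativeRing = quotientRing
    ; ι = constP K G
    ; ι-cong = λ e → ≈ₚ⇒≈ᴰ (constant-cong e ≡.refl)
    ; ι-+ = λ x y → ≈ₚ⇒≈ᴰ (constP-+ x y)
    ; ι-* = λ x y → ≈ₚ⇒≈ᴰ (constant-cong K.refl (≡.sym (0+ᵛ (Vec.replicate (suc n) 0))))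
    ; ι-1 = ≈ₚ⇒≈ᴰ P.refl }

  open KAlgebra 𝓓

  ≈0⇒InIdeal : ∀ p → p ≈ 0# → InIdeal K G p
  ≈0⇒InIdeal p (modulo-ideal d) = InIdeal-cong (P.reflexive (Listₚ.++-identityʳ p)) d

  y : Fin (suc n) → Poly K G
  y l = (K.1# , unit l) ∷ []

  -- In 𝓓_G a polynomial is its own value at the classes of the variables. This turns the vanishing
  -- of an evaluation, as supplied by `universal`, into membership in the ideal.
  evaluate-self : ∀ p → p ≈ Evaluation.evaluate K G 𝓓 y p
  evaluate-self = Evaluation.evaluate-unique K G 𝓓 y (λ p → p) refl (λ x μ p → refl)
    (λ x μ → ≈ₚ⇒≈ᴰ (constant-cong (K.sym (K.*-identityʳ x)) (≡.sym (0+ᵛ μ)))) refl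
    (λ μ ν → ≈ₚ⇒≈ᴰ (constant-cong (K.sym (K.*-identityˡ K.1#)) ≡.refl)) (λ l → refl)

  gen≈0 : ∀ S → Nonempty S → gen K G S ≈ 0#
  gen≈0 S ne = modulo-ideal (((constP K G K.1# , S , ne) ∷ []) , coefficients (one-term (gen K G S)))
    where
    one-term : ∀ g → (g ++ []) ≈ₚ (mulP K G (constP K G K.1#) g ++ [])
    one-term g = P.+-congʳ (P.sym (P.*-identityˡ g))

  evaluate-gen≈0 : ∀ S → Nonempty S → Evaluation.evaluate K G 𝓓 y (gen K G S) ≈ 0#
  evaluate-gen≈0 S ne = trans (sym (evaluate-self (gen K G S))) (gen≈0 S ne)

-- Φ_G as iterated dual numbers.

module SquareFree {c ℓ} (K : CommutativeRing c ℓ) (inv : ℕ → CommutativeRing.Carrier K)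
  (inv-correct : ∀ k → CommutativeRing._≈_ K (CommutativeRing._*_ K (natK K (suc k)) (inv k)) (CommutativeRing.1# K))
  where
  private module K = CommutativeRing K
  open FreeAlgebra K
  open AdditiveTheorem K inv inv-correct
  open MultiplicativeTheorem K inv inv-correct
  private module T (k : ℕ) = KAlgebra (tower k)

  Fun : ℕ → Set c
  Fun k = Subset k → K.Carrier

  sum-subsets : ∀ k → Fun k → K.Carrier
  sum-subsets k F = sumK K (List.map F (allSubsets k))

  sumK-++ : ∀ xs ys → sumK K (xs ++ ys) K.≈ sumK K xs K.+ sumK K ys
  sumK-++ [] ys = K.sym (K.+-identityˡ _)
  sumK-++ (x ∷ xs) ys = K.trans (K.+-congˡ (sumK-++ xs ys)) (K.sym (K.+-assoc _ _ _))

  sum-subsets-suc : ∀ k F → sum-subsets (suc k) F K.≈ sum-subsets k (λ A → F (false ∷ A)) K.+ sum-subsets k (λ A → F (true ∷ A))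
  sum-subsets-suc k F = K.trans
    (K.reflexive (≡.cong (sumK K) (≡.trans (Listₚ.map-++ F (List.map (false ∷_) (allSubsets k)) (List.map (true ∷_) (allSubsets k)))
      (≡.cong₂ _++_ (≡.sym (Listₚ.map-∘ (allSubsets k))) (≡.sym (Listₚ.map-∘ (allSubsets k)))))))
    (sumK-++ (List.map (λ A → F (false ∷ A)) (allSubsets k)) (List.map (λ A → F (true ∷ A)) (allSubsets k)))

  sum-subsets-zero : ∀ k → sum-subsets k (λ _ → K.0#) K.≈ K.0#
  sum-subsets-zero k = go (allSubsets k)
    where
    go : ∀ (As : List (Subset k)) → sumK K (List.map (λ _ → K.0#) As) K.≈ K.0#
    go [] = K.refl
    go (_ ∷ As) = K.trans (K.+-identityˡ _) (go As)

  -- The product `_*Φ_` for any number of edges, as induction on edges requires; at `m G` edges the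
  -- two agree definitionally.
  _⊛_ : ∀ {k} → Fun k → Fun k → Fun k
  _⊛_ {k} f g S = sum-subsets k (λ A → if A ⊆ᵇ S then f A K.* g (S ∖ᵇ A) else K.0#)

  one : ∀ {k} → Fun k
  one {k} S = if S =ᵇ Vec.replicate k false then K.1# else K.0#

  -- The first edge e splits an element into f₀ + φ_e f₁, according to whether a subset contains e.
  toTower : ∀ {k} → Fun k → KAlgebra.Carrier (tower k)
  toTower {zero} f = f []
  toTower {suc k} f = toTower (λ S → f (false ∷ S)) , toTower (λ S → f (true ∷ S))

  toTower-cong : ∀ {k} {f g : Fun k} → (∀ S → f S K.≈ g S) → T._≈_ k (toTower f) (toTower g)
  toTower-cong {zero} e = e []
  toTower-cong {suc k} e = toTower-cong (λ S → e (false ∷ S)) , toTower-cong (λ S → e (true ∷ S))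

  toTower-injective : ∀ {k} {f g : Fun k} → T._≈_ k (toTower f) (toTower g) → ∀ S → f S K.≈ g S
  toTower-injective {zero} e [] = e
  toTower-injective {suc k} {f} {g} (e , e′) (false ∷ S) = toTower-injective {k} {λ S → f (false ∷ S)} {λ S → g (false ∷ S)} e S
  toTower-injective {suc k} {f} {g} (e , e′) (true ∷ S) = toTower-injective {k} {λ S → f (true ∷ S)} {λ S → g (true ∷ S)} e′ S

  toTower-0 : ∀ {k} → T._≈_ k (toTower {k} (λ _ → K.0#)) (T.0# k)
  toTower-0 {zero} = K.refl
  toTower-0 {suc k} = toTower-0 {k} , toTower-0 {k}

  toTower-+ : ∀ {k} (f g : Fun k) → T._≈_ k (toTower (λ S → f S K.+ g S)) (T._+_ k (toTower f) (toTower g))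
  toTower-+ {zero} f g = K.refl
  toTower-+ {suc k} f g = toTower-+ (λ S → f (false ∷ S)) (λ S → g (false ∷ S)) , toTower-+ (λ S → f (true ∷ S)) (λ S → g (true ∷ S))

  toTower-scale : ∀ {k} x (f : Fun k) → T._≈_ k (toTower (λ S → x K.* f S)) (T._*_ k (T.ι k x) (toTower f))
  toTower-scale {zero} x f = K.refl
  toTower-scale {suc k} x f = toTower-scale x (λ S → f (false ∷ S)) ,
    A.trans (toTower-scale x (λ S → f (true ∷ S)))
      (A.solve 2 (λ x y → x A.:= x A.:+ A.:0 A.:* y) A.refl (A.ι x A.* toTower (λ S → f (true ∷ S))) (toTower (λ S → f (false ∷ S))))
    where
    module A = T k

  toTower-1 : ∀ {k} → T._≈_ k (toTower (one {k})) (T.1# k)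
  toTower-1 {zero} = K.refl
  toTower-1 {suc k} = toTower-1 {k} , toTower-0 {k}

  ⊛-false : ∀ {k} (f g : Fun (suc k)) S →
    (f ⊛ g) (false ∷ S) K.≈ ((λ A → f (false ∷ A)) ⊛ (λ A → g (false ∷ A))) S
  ⊛-false {k} f g S = K.trans (sum-subsets-suc k _) (K.trans (K.+-congˡ (sum-subsets-zero k)) (K.+-identityʳ _))

  -- The first edge comes from the left or from the right factor, never from both, because φ_e² = 0;
  -- these are the two terms of the ε-part in `dual`.
  ⊛-true : ∀ {k} (f g : Fun (suc k)) S →
    (f ⊛ g) (true ∷ S) K.≈ ((λ A → f (false ∷ A)) ⊛ (λ A → g (true ∷ A))) S K.+ ((λ A → f (true ∷ A)) ⊛ (λ A → g (false ∷ A))) S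
  ⊛-true {k} f g S = sum-subsets-suc k _

  toTower-* : ∀ {k} (f g : Fun k) → T._≈_ k (toTower (f ⊛ g)) (T._*_ k (toTower f) (toTower g))
  toTower-* {zero} f g = K.+-identityʳ _
  toTower-* {suc k} f g =
    A.trans (toTower-cong (⊛-false f g)) (toTower-* f₀ g₀) ,
    A.trans (toTower-cong (⊛-true f g)) (A.trans (toTower-+ (f₀ ⊛ g₁) (f₁ ⊛ g₀)) (A.+-cong (toTower-* f₀ g₁) (toTower-* f₁ g₀)))
    where
    module A = T k
    f₀ f₁ g₀ g₁ : Fun k
    f₀ S = f (false ∷ S)
    f₁ S = f (true ∷ S)
    g₀ S = g (false ∷ S)
    g₁ S = g (true ∷ S)

  -- `allFin` is `tabulate id`, whose tail is no longer of this form; the index map `ix` makes the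
  -- induction go through.
  toTower-foldr : ∀ {k M} (h : Fin M → Fun k) {N} (ix : Fin N → Fin M) →
    T._≈_ k (toTower (List.foldr (λ e acc → h e ⊛ acc) one (List.tabulate ix))) (T.product k (λ e → toTower (h (ix e))))
  toTower-foldr {k} h {zero} ix = toTower-1 {k}
  toTower-foldr {k} h {suc N} ix = A.trans
    (toTower-* (h (ix zero)) (List.foldr (λ e acc → h e ⊛ acc) one (List.tabulate (ix ∘ suc))))
    (A.*-congˡ (toTower-foldr h (ix ∘ suc)))
    where
    module A = T k

  φᵗ : ∀ {k} → Fin k → KAlgebra.Carrier (tower k)
  φᵗ {suc k} zero = T.0# k , T.1# k
  φᵗ {suc k} (suc e) = φᵗ e , T.0# k

  toTower-φ : ∀ {k} (e : Fin k) → T._≈_ k (toTower (λ S → if S =ᵇ ⁅ e ⁆ then K.1# else K.0#)) (φᵗ e)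
  toTower-φ {suc k} zero = toTower-0 {k} , toTower-1 {k}
  toTower-φ {suc k} (suc e) = toTower-φ e , toTower-0 {k}

  Yᵗ-product : ∀ {N k} (es : Edges N k) l →
    T._≈_ k (T.product k (λ e → T._+_ k (T.1# k) (T._*_ k (T.ι k (incidence (es e) l)) (φᵗ e)))) (Yᵗ es l)
  Yᵗ-product {k = zero} es l = K.refl
  Yᵗ-product {k = suc k} es l = D.trans (D.*-cong first rest) combine
    where
    module A = T k
    module D = T (suc k)
    a : Fin k → A.Carrier
    a e = A.1# A.+ A.ι (incidence (es (suc e)) l) A.* φᵗ e
    x = A.ι (incidence (es zero) l)
    first : (D.1# D.+ D.ι (incidence (es zero) l) D.* φᵗ {suc k} zero) D.≈ (A.1# , x)
    first = A.solve 1 (λ x → A.:1 A.:+ x A.:* A.:0 A.:= A.:1) A.refl x ,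
            A.solve 1 (λ x → A.:0 A.:+ (x A.:* A.:1 A.:+ A.:0 A.:* A.:0) A.:= x) A.refl x
    product-scalar : ∀ {M} (a : Fin M → A.Carrier) → D.product (λ e → a e , A.0#) D.≈ (A.product a , A.0#)
    product-scalar {zero} a = D.refl
    product-scalar {suc M} a = D.trans (D.*-congˡ (product-scalar (a ∘ suc)))
      (A.refl , A.solve 2 (λ x y → x A.:* A.:0 A.:+ A.:0 A.:* y A.:= A.:0) A.refl (a zero) (A.product (a ∘ suc)))
    rest : D.product (λ e → D.1# D.+ D.ι (incidence (es (suc e)) l) D.* φᵗ (suc e)) D.≈ (Yᵗ (es ∘ suc) l , A.0#)
    rest = D.trans (D.product-cong (λ e → A.refl ,
        A.solve 2 (λ x y → A.:0 A.:+ (x A.:* A.:0 A.:+ A.:0 A.:* y) A.:= A.:0) A.refl (A.ι (incidence (es (suc e)) l)) (φᵗ e)))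
      (D.trans (product-scalar a) (Yᵗ-product (es ∘ suc) l , A.refl))
    combine : ((A.1# , x) D.* (Yᵗ (es ∘ suc) l , A.0#)) D.≈ Yᵗ es l
    combine = A.*-identityˡ _ , A.solve 2 (λ x y → A.:1 A.:* A.:0 A.:+ x A.:* y A.:= x A.:* y) A.refl x (Yᵗ (es ∘ suc) l)

-- The isomorphism of 𝓓_G and 𝓚_G.

module Presentation {c ℓ} (K : CommutativeRing c ℓ) (inv : ℕ → CommutativeRing.Carrier K)
  (inv-correct : ∀ k → CommutativeRing._≈_ K (CommutativeRing._*_ K (natK K (suc k)) (inv k)) (CommutativeRing.1# K))
  {n : ℕ} (G : Graph n) where
  private module K = CommutativeRing K
  open FreeAlgebra K
  open AdditiveTheorem K inv inv-correct
  open MultiplicativeTheorem K inv inv-correct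
  open SquareFree K inv inv-correct
  private module T = KAlgebra (tower (m G))

  -- The smaller end is listed first and so gets the coefficient 1 in `incidence`, which is the sign
  -- convention of c_{i,e}.
  oriented : Edges (suc n) (m G)
  oriented e = if does (src G e Fin.<? tgt G e) then (src G e , tgt G e) else (tgt G e , src G e)

  cut-D : ∀ f S → (∀ l → Vec.lookup S l ≡ f l) → D G S ≡ cut oriented f
  cut-D f S S≗f = ≡.trans (≡.cong ListAction.sum (Listₚ.map-tabulate id crossing)) (go oriented crossing crossing-oriented)
    where
    crossing : Fin (m G) → ℕ
    crossing e = if (src G e ∈ᵇ S) xor (tgt G e ∈ᵇ S) then 1 else 0
    crossing-oriented : ∀ e → crossing e ≡ (if f (proj₁ (oriented e)) xor f (proj₂ (oriented e)) then 1 else 0)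
    crossing-oriented e rewrite S≗f (src G e) | S≗f (tgt G e) with does (src G e Fin.<? tgt G e)
    ... | true = ≡.refl
    ... | false = ≡.cong (λ b → if b then 1 else 0) (Boolₚ.xor-comm (f (src G e)) (f (tgt G e)))
    go : ∀ {k} (es : Edges (suc n) k) (h : Fin k → ℕ) → (∀ e → h e ≡ (if f (proj₁ (es e)) xor f (proj₂ (es e)) then 1 else 0)) →
      ListAction.sum (List.tabulate h) ≡ cut es f
    go {zero} es h e = ≡.refl
    go {suc k} es h e = ≡.cong₂ ℕ._+_ (e zero) (go (es ∘ suc) (h ∘ suc) (e ∘ suc))

  coef-incidence : ∀ l e → coef K G l e K.≈ incidence (oriented e) l
  coef-incidence l e = by-order (src G e) (tgt G e) (loopless G e) (l Fin.≟ src G e) (l Fin.≟ tgt G e)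
    where
    module KS = IntegerSolver K
    by-order : ∀ s t → s ≢ t → Dec (l ≡ s) → Dec (l ≡ t) →
      (if does (l Fin.≟ s) then (if does (s Fin.<? t) then K.1# else K.- K.1#)
        else (if does (l Fin.≟ t) then (if does (t Fin.<? s) then K.1# else K.- K.1#) else K.0#))
      K.≈ incidence (if does (s Fin.<? t) then (s , t) else (t , s)) l
    by-order s t s≢t l≟s l≟t with Finₚ.<-cmp s t
    -- Looplessness enters here: for a loop, `coef` would be -1 at its vertex, whereas `incidence`
    -- is zero.
    by-order s t s≢t l≟s l≟t | tri≈ _ s≡t _ = contradiction s≡t s≢t
    by-order s t s≢t l≟s l≟t | tri< s<t _ t≮s rewrite dec-true (s Fin.<? t) s<t | dec-false (t Fin.<? s) t≮s = cases l≟s l≟t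
      where
      cases : Dec (l ≡ s) → Dec (l ≡ t) → (if does (l Fin.≟ s) then K.1# else (if does (l Fin.≟ t) then K.- K.1# else K.0#)) K.≈ incidence (s , t) l
      cases (yes ≡.refl) _ rewrite dec-true (l Fin.≟ l) ≡.refl | dec-false (l Fin.≟ t) s≢t = KS.solve 0 (KS.:1 KS.:= KS.:1 KS.:- KS.:0) K.refl
      cases (no l≢s) (yes ≡.refl) rewrite dec-false (l Fin.≟ s) l≢s | dec-true (l Fin.≟ l) ≡.refl = K.sym (K.+-identityˡ _)
      cases (no l≢s) (no l≢t) rewrite dec-false (l Fin.≟ s) l≢s | dec-false (l Fin.≟ t) l≢t = K.sym (K.-‿inverseʳ K.0#)
    by-order s t s≢t l≟s l≟t | tri> s≮t _ t<s rewrite dec-false (s Fin.<? t) s≮t | dec-true (t Fin.<? s) t<s = cases l≟s l≟t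
      where
      cases : Dec (l ≡ s) → Dec (l ≡ t) → (if does (l Fin.≟ s) then K.- K.1# else (if does (l Fin.≟ t) then K.1# else K.0#)) K.≈ incidence (t , s) l
      cases (yes ≡.refl) _ rewrite dec-true (l Fin.≟ l) ≡.refl | dec-false (l Fin.≟ t) s≢t = K.sym (K.+-identityˡ _)
      cases (no l≢s) (yes ≡.refl) rewrite dec-false (l Fin.≟ s) l≢s | dec-true (l Fin.≟ l) ≡.refl = KS.solve 0 (KS.:1 KS.:= KS.:1 KS.:- KS.:0) K.refl
      cases (no l≢s) (no l≢t) rewrite dec-false (l Fin.≟ s) l≢s | dec-false (l Fin.≟ t) l≢t = K.sym (K.-‿inverseʳ K.0#)

  toTower-Y : ∀ l → toTower (Y K G l) T.≈ Yᵗ oriented l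
  toTower-Y l = T.trans (toTower-foldr factor id) (T.trans (T.product-cong factor-correct) (Yᵗ-product oriented l))
    where
    factor : Fin (m G) → Phi K G
    factor e = _+Φ_ K G (oneΦ K G) (scaleΦ K G (coef K G l e) (φ K G e))
    factor-correct : ∀ e → toTower (factor e) T.≈ T.1# T.+ T.ι (incidence (oriented e) l) T.* φᵗ e
    factor-correct e = T.trans (toTower-+ (oneΦ K G) (scaleΦ K G (coef K G l e) (φ K G e)))
      (T.+-cong (toTower-1 {m G}) (T.trans (toTower-scale (coef K G l e) (φ K G e))
        (T.*-cong (T.ι-cong (coef-incidence l e)) (toTower-φ e))))

  toTower-pow : ∀ f k → toTower (powΦ K G f k) T.≈ toTower f T.^ k
  toTower-pow f zero = toTower-1 {m G}
  toTower-pow f (suc k) = T.trans (toTower-* f (powΦ K G f k)) (T.*-congˡ (toTower-pow f k))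

  toTower-mono : ∀ μ → toTower (monoΦ K G μ) T.≈ T.product (λ l → Yᵗ oriented l T.^ Vec.lookup μ l)
  toTower-mono μ = T.trans (toTower-foldr (λ i → powΦ K G (Y K G i) (Vec.lookup μ i)) id)
    (T.product-cong (λ l → T.trans (toTower-pow (Y K G l) (Vec.lookup μ l)) (T.^-congˡ (Vec.lookup μ l) (toTower-Y l))))

  private
    module Ev = Evaluation K G (tower (m G)) (Yᵗ oriented)

  toTower-evalY : ∀ p → toTower (evalY K G p) T.≈ Ev.evaluate p
  toTower-evalY [] = T.trans (toTower-0 {m G}) (T.sym Ev.evaluate-[])
  toTower-evalY ((x , μ) ∷ p) = T.trans (toTower-+ (scaleΦ K G x (monoΦ K G μ)) (evalY K G p))
    (T.trans (T.+-cong (T.trans (toTower-scale x (monoΦ K G μ)) (T.*-congˡ (toTower-mono μ))) (toTower-evalY p))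
      (T.sym (Ev.evaluate-term x μ p)))

  relation-Y : ∀ S → (T.product (λ l → if Vec.lookup S l then Yᵗ oriented l else T.1#) T.- T.1#) T.^ suc (D G S) T.≈ T.0#
  relation-Y S = T.trans (T.^-congʳ _ (≡.cong suc (cut-D (Vec.lookup S) S (λ _ → ≡.refl)))) (Yᵗ-power oriented (Vec.lookup S))

  -- Evaluating a list polynomial in the free algebra itself turns it into a term, to which
  -- `multiplicative-complete` applies.
  expression : Poly K G → Expr (suc n)
  expression = Evaluation.evaluate K G (free (suc n)) var
  eval-expression : ∀ {a b} (A : KAlgebra K a b) y p → KAlgebra._≈_ A (eval A y (expression p)) (Evaluation.evaluate K G A y p)
  eval-expression A y [] = trans (eval-cong A y (Evaluation.evaluate-[] K G (free (suc n)) var))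
    (trans ι-0 (sym (Evaluation.evaluate-[] K G A y)))
    where
    open KAlgebra A
  eval-expression A y ((x , μ) ∷ p) = trans (eval-cong A y (Evaluation.evaluate-term K G (free (suc n)) var x μ p))
    (trans (+-cong (*-congˡ (trans (eval-product A y (λ l → var l E.^ Vec.lookup μ l))
        (product-cong (λ l → eval-^ A y (var l) (Vec.lookup μ l))))) (eval-expression A y p))
      (sym (Evaluation.evaluate-term K G A y x μ p)))
    where
    open KAlgebra A
    module E = KAlgebra (free (suc n))

  module _ {a b} (A : KAlgebra K a b) (y : Fin (suc n) → KAlgebra.Carrier A) where
    open KAlgebra A
    open Evaluation K G A y using (evaluate; relation)

    -- A family that satisfies the defining relations of 𝓓_G in some algebra satisfies every
    -- polynomial relation among the Y_l. Applied to 𝓓_G itself, this is injectivity.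
    universal : (∀ S → Nonempty S → evaluate (gen K G S) ≈ 0#) → ∀ p → Ev.evaluate p T.≈ T.0# → evaluate p ≈ 0#
    universal H p e = trans (sym (eval-expression A y p))
      (multiplicative-complete A oriented y
        (λ f → trans (^-congʳ _ (≡.cong suc (≡.sym (cut-D f (Vec.tabulate f) (Vecₚ.lookup∘tabulate f))))) (relation H f))
        (expression p) (T.trans (eval-expression (tower (m G)) (Yᵗ oriented) p) e))

  -- `InK` and `InKFilt` are defined through `evalY`, the map itself, so image and filtration are
  -- immediate. The content is that the kernel is the ideal: `ψ-cong` is one inclusion and `ψ-inj`
  -- the other.
  isomorphism : FilteredIso K G
  isomorphism = record
    { ψ = evalY K G
    ; ψ-cong = λ p q d → from-evaluate p q (T.x-y≈0⇒x≈y (T.trans (T.sym (difference-correct p q)) (Ev.evaluate-InIdeal relation-Y (p ++ negP K G q) d)))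
    ; ψ-into = λ p → p , λ S → K.refl
    ; ψ-add = λ p q → toTower-injective (T.trans (toTower-evalY (p ++ q)) (T.trans (Ev.evaluate-+ p q)
        (T.sym (T.trans (toTower-+ (evalY K G p) (evalY K G q)) (T.+-cong (toTower-evalY p) (toTower-evalY q))))))
    ; ψ-scale = λ x p → toTower-injective (T.trans (toTower-evalY (scaleP K G x p)) (T.trans (Ev.evaluate-scale x p)
        (T.sym (T.trans (toTower-scale x (evalY K G p)) (T.*-congˡ (toTower-evalY p))))))
    ; ψ-mul = λ p q → toTower-injective (T.trans (toTower-evalY (mulP K G p q)) (T.trans (Ev.evaluate-* p q)
        (T.sym (T.trans (toTower-* (evalY K G p) (evalY K G q)) (T.*-cong (toTower-evalY p) (toTower-evalY q))))))
    ; ψ-one = toTower-injective (T.trans (toTower-evalY (constP K G K.1#)) (T.trans Ev.evaluate-1 (T.sym (toTower-1 {m G}))))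
    ; ψ-inj = λ p q e → ≈0⇒InIdeal (p ++ negP K G q) (trans (evaluate-self (p ++ negP K G q))
        (universal 𝓓 y evaluate-gen≈0 (p ++ negP K G q) (T.trans (difference-correct p q)
          (T.x≈y⇒x-y≈0 (T.trans (T.sym (toTower-evalY p)) (T.trans (toTower-cong e) (toTower-evalY q)))))))
    ; ψ-surj = λ x x∈𝓚 → x∈𝓚
    ; ψ-filt = λ k p deg → p , deg , λ S → K.refl
    ; ψ-filt-onto = λ k x x∈𝓚ₖ → x∈𝓚ₖ }
    where
    open QuotientAlgebra K G
    open KAlgebra 𝓓 using (trans)
    difference-correct : ∀ p q → Ev.evaluate (p ++ negP K G q) T.≈ Ev.evaluate p T.- Ev.evaluate q
    difference-correct p q = T.trans (Ev.evaluate-+ p (negP K G q)) (T.+-congˡ (Ev.evaluate-neg q))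
    from-evaluate : ∀ p q → Ev.evaluate p T.≈ Ev.evaluate q → _≈Φ_ K G (evalY K G p) (evalY K G q)
    from-evaluate p q e = toTower-injective (T.trans (toTower-evalY p) (T.trans e (T.sym (toTower-evalY q))))

theorem3 : ∀ {c ℓ} (K : CommutativeRing c ℓ) → IsField K → CharZero K →
    (n : ℕ) (G : Graph n) → FilteredIso K G
theorem3 K (_ , inverse) charZero n G =
  -- In characteristic zero `natK K (suc k)` is nonzero, so the field inverts it; these inverses
  -- feed the exponential series and the integration along edges.
  Presentation.isomorphism K (λ k → proj₁ (inverse (natK K (suc k)) (charZero k))) (λ k → proj₂ (inverse (natK K (suc k)) (charZero k))) G
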